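{- For every planar multigraph $M$ on $n \geq 1$ vertices admitting an embedding into the plane without $2$-faces, $a(M) \geq \frac{3}{10}n+\frac{7}{30}$.
   Context: Multigraphs are finite, may have parallel edges, but have no loops. For a multigraph $M$, $a(M)$ denotes the maximum number of vertices of an induced forest in $M$ (a $2$-cycle formed by two parallel edges counts as a cycle). In a plane embedding, each edge is considered to have two sides; the degree of a face $f$ is the number of incidences between $f$ and sides of edges (an edge with the same face on both sides contributes $2$). A $2$-face is a face of degree $2$. -}

module Defs where

open import Data.Nat using (ℕ; zero; suc; _+_; _≤_)
import Data.Fin as Fin
open import Data.Fin using (Fin; _↑ˡ_; _↑ʳ_; splitAt; inject₁; fromℕ)
open import Data.Fin.Subset using (Subset; _∈_)
open import Data.Product using (_×_; _,_; proj₁; proj₂; ∃; ∃-syntax)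
open import Data.Sum using (_⊎_; [_,_])
open import Data.Bool using (Bool; true; false; not)
open import Relation.Binary.PropositionalEquality using (_≡_; _≢_)
open import Relation.Binary.Construct.Closure.ReflexiveTransitive using (Star)
open import Relation.Nullary using (¬_)
open import Function.Definitions using (Injective)

record Multigraph (n : ℕ) : Set where
  field
    m        : ℕ
    ends     : Fin m → Fin n × Fin n
    loopless : ∀ e → proj₁ (ends e) ≢ proj₂ (ends e)

open Multigraph public

Joins : ∀ {n m} → (Fin m → Fin n × Fin n) → Fin m → Fin n → Fin n → Set
Joins ends e u v = ends e ≡ (u , v) ⊎ ends e ≡ (v , u)

-- Cycles and induced forests.
-- A cycle of length k ≥ 2: closed walk vs 0, e 0, vs 1, ..., e (k-1), vs k = vs 0
-- with pairwise distinct vertices vs 0..vs (k-1) and pairwise distinct edges.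
-- (k = 2 gives a 2-cycle formed by two parallel edges.)

record Cycle {n} (M : Multigraph n) : Set where
  field
    len     : ℕ
    len≥2   : 2 ≤ len
    vs      : Fin (suc len) → Fin n
    es      : Fin len → Fin (m M)
    closed  : vs (fromℕ len) ≡ vs Fin.zero
    vs-inj  : Injective _≡_ _≡_ (λ i → vs (inject₁ i))
    es-inj  : Injective _≡_ _≡_ es
    joins   : ∀ i → Joins (ends M) (es i) (vs (inject₁ i)) (vs (Fin.suc i))

open Cycle public

-- S induces a forest: no cycle of M has all its vertices in S
-- (such a cycle is exactly a cycle of the induced sub-multigraph M[S]).
InducedForest : ∀ {n} → Multigraph n → Subset n → Set
InducedForest M S = ¬ (Σ' (Cycle M) λ C → ∀ i → vs C i ∈ S)
  where
  open import Data.Product using () renaming (Σ to Σ')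

-- Plane embeddings via combinatorial maps.
--
-- A plane embedding of M (possibly disconnected) is encoded by a
-- connected, loopless supergraph M⁺ = M + (k extra edges) on the same
-- vertices together with a genus-0 rotation system of M⁺; the embedding
-- of M is obtained by deleting the extra edges. Darts = sides of edges.
-- Faces of M⁺ are the orbits of φ = σ ∘ α.  The faces of M are obtained
-- by merging the faces of M⁺ on the two sides of each deleted extra edge;
-- the degree of a face of M is the number of M-darts (sides of M-edges)
-- in it.

iter : ∀ {A : Set} → (A → A) → ℕ → A → A
iter f zero    x = x
iter f (suc j) x = f (iter f j x)

module _ {n : ℕ} (M : Multigraph n) (k : ℕ)
         (xends : Fin k → Fin n × Fin n) where

  E⁺ : ℕ
  E⁺ = m M + k

  ends⁺ : Fin E⁺ → Fin n × Fin n
  ends⁺ e = [ ends M , xends ] (splitAt (m M) e)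

  Dart : Set
  Dart = Fin E⁺ × Bool

  α : Dart → Dart
  α (e , b) = e , not b

  head : Dart → Fin n
  head (e , false) = proj₁ (ends⁺ e)
  head (e , true)  = proj₂ (ends⁺ e)

  Adj⁺ : Fin n → Fin n → Set
  Adj⁺ u v = ∃ λ e → Joins ends⁺ e u v

  realDart : Fin (m M) × Bool → Dart
  realDart (e , b) = (e ↑ˡ k) , b

  IsExtra : Dart → Set
  IsExtra d = ∃ λ (x : Fin k) → proj₁ d ≡ m M ↑ʳ x

  data Step (σ : Dart → Dart) : Dart → Dart → Set where
    φ-step : ∀ d → Step σ d (σ (α d))
    x-step : ∀ d → IsExtra d → Step σ d (α d)

  SameFace : (Dart → Dart) → Dart → Dart → Set
  SameFace σ = Star (Step σ)

record PlaneEmbeddingWithout2Faces {n : ℕ} (M : Multigraph n) : Set where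
  field
    k          : ℕ
    xends      : Fin k → Fin n × Fin n
    xloopless  : ∀ x → proj₁ (xends x) ≢ proj₂ (xends x)
    connected  : ∀ u v → Star (Adj⁺ M k xends) u v
    σ          : Dart M k xends → Dart M k xends
    σ⁻¹        : Dart M k xends → Dart M k xends
    σσ⁻¹       : ∀ d → σ (σ⁻¹ d) ≡ d
    σ⁻¹σ       : ∀ d → σ⁻¹ (σ d) ≡ d
    σ-head     : ∀ d → head M k xends (σ d) ≡ head M k xends d
    σ-trans    : ∀ d d' → head M k xends d ≡ head M k xends d' →
                 ∃ λ j → iter σ j d ≡ d'
    -- faces of M⁺: F = number of orbits of φ = σ ∘ α, realised by a
    -- labelling whose fibres are exactly the φ-orbits
    F          : ℕ
    face       : Dart M k xends → Fin F
    face-φ     : ∀ d → face (σ (α M k xends d)) ≡ face d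
    face-surj  : ∀ f → ∃ λ d → face d ≡ f
    face-orbit : ∀ d d' → face d ≡ face d' →
                 ∃ λ j → iter (λ x → σ (α M k xends x)) j d ≡ d'
    -- genus 0 (Euler's formula V - E + F = 2 for the connected map M⁺;
    -- a single vertex with no edges is trivially plane)
    euler      : m M + k ≡ 0 ⊎ n + F ≡ (m M + k) + 2
  field
    no2face : ¬ (∃ λ d₁ → ∃ λ d₂ → d₁ ≢ d₂ ×
                  SameFace M k xends σ (realDart M k xends d₁) (realDart M k xends d₂) ×
                  (∀ d → SameFace M k xends σ (realDart M k xends d₁) (realDart M k xends d) →
                         d ≡ d₁ ⊎ d ≡ d₂))

module Submission where

-- Two parallel edges of a plane map bound a disk, a "digon", which contains an edge since there are no 2-faces.
-- Collapsing innermost digons one after the other, each to a single marked edge, leaves a simple plane graph, and the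
-- pieces cut off are simple as well. In reverse order we extend three induced forests, not containing both ends of a
-- marked edge, piece by piece, until their total size is at least n + 1; hence one of them has (n + 1) / 3 vertices.
-- By Euler's formula the vertices of a piece can be ordered such that each one has at most five edges to earlier
-- vertices, even if edges to the first vertex x of the piece count twice. So each vertex has at most one edge to one
-- of the forests, unless it has to be dropped because of a marked edge to an earlier vertex. Every collapsed digon
-- must make up for one such loss. If its piece has no marked edges, then x fits in two of the forests; otherwise x is
-- chosen on a marked edge, and the marked edges at x cause no loss.

open import Defs using (Multigraph; m; ends; loopless; Joins; Cycle; module Cycle; InducedForest; PlaneEmbeddingWithout2Faces; module PlaneEmbeddingWithout2Faces; iter; ends⁺; Dart; α; head; Adj⁺; realDart; SameFace; φ-step; x-step)
open import Algebra.Bundles using (CommutativeRing)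
open import Data.Bool as Bool using (Bool; true; false; not; if_then_else_; _∧_; _∨_; _xor_)
open import Data.Bool.Properties using (xor-∧-commutativeRing; ¬-not; ∧-identityʳ; ∧-zeroʳ; ∨-identityʳ; xor-same; xor-assoc; xor-comm; xor-identityʳ; xor-annihilates-not)
open import Data.Empty using (⊥; ⊥-elim)
open import Data.Fin as Fin using (Fin; zero; suc; _≟_; _↑ˡ_; _↑ʳ_; splitAt; punchIn; punchOut; inject₁; fromℕ)
open import Data.Fin.Permutation using (Permutation; permutation)
open import Data.Fin.Properties using (any?; punchInᵢ≢i; punchOut-punchIn; punchOut-cong; splitAt-↑ˡ; splitAt-↑ʳ; splitAt⁻¹-↑ˡ; splitAt⁻¹-↑ʳ; ↑ˡ-injective) renaming (suc-injective to Fin-suc-injective)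
open import Data.Fin.Subset as Subset using (Subset; ∣_∣; ⊤)
open import Data.Fin.Subset.Properties using (∣⊤∣≡n)
open import Data.List using (List; []; _∷_; length)
open import Data.List.Membership.Propositional using (_∈_; _∉_)
import Data.List.Membership.DecPropositional as DecMembership
open import Data.List.Relation.Unary.Any using (here; there)
open import Data.Nat using (ℕ; zero; suc; _+_; _*_; _≤_; _<_; z≤n; s≤s; _≤?_)
open import Data.Nat.Properties hiding (_≟_)
open import Data.Nat.Tactic.RingSolver using (solve-∀)
open import Data.Product using (_×_; _,_; proj₁; proj₂; ∃; ∃-syntax; Σ-syntax)
open import Data.Sum as Sum using (_⊎_; inj₁; inj₂; [_,_]′)
open import Data.Vec using (tabulate)
open import Data.Vec.Properties using (lookup∘tabulate; []=⇒lookup)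
open import Function using (_∘_; case_of_; id)
open import Relation.Binary.Construct.Closure.ReflexiveTransitive using (Star; ε; _◅_; _◅◅_)
open import Relation.Binary.PropositionalEquality
open import Relation.Nullary using (¬_; Dec; yes; no; does; contradiction)
open import Relation.Nullary.Decidable using (dec-true; dec-false; _×-dec_; _⊎-dec_; ¬?)
open import Algebra.Properties.CommutativeMonoid.Sum +-0-commutativeMonoid using (sum; ∑-distrib-+; ∑-comm; sum-cong-≗)
open import Algebra.Properties.CommutativeMonoid.Sum (CommutativeRing.+-commutativeMonoid xor-∧-commutativeRing) using () renaming (sum to xsum; ∑-distrib-+ to xsum-distrib; sum-permute to xsum-permute; sum-cong-≗ to xsum-cong; sum-remove to xsum-remove)

-- Finite counting

-- Parity replaces the Jordan curve theorem: a disk is a set of faces with just two boundary edges,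
-- and face boundaries meet vertex cuts evenly. The invariant that survives collapsing reads: number
-- of vertices + 1 is at most the total size of the forests + number of marked edges. A collapse may
-- create one marked edge, so the extension to its piece must win one unit more than the piece has
-- new vertices, after one unit is granted for each marked edge of the piece. A second copy of `x`
-- wins it if there are no such edges; otherwise a marked edge at `x` is never charged. The number
-- five is what three forests allow: five edges leave some forest with at most one. Since `x` may
-- lie in two forests, its edges weigh two, so Euler's bound is applied to two vertex sets. For `w`
-- vertices it gives total weight at most 3(w+3) - 6 + 3(w+1) - 6 = 6w, which would only yield a
-- vertex of weight six; the edge on which the piece is glued is counted there without being a load,
-- and makes the inequality strict.

⟦_⟧ : Bool → ℕ
⟦ true ⟧ = 1
⟦ false ⟧ = 0

true≢false : true ≢ false
true≢false ()

infix 4 _==_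
_==_ : ∀ {n} → Fin n → Fin n → Bool
i == j = does (i ≟ j)

==-refl : ∀ {n} (i : Fin n) → (i == i) ≡ true
==-refl i = dec-true (i ≟ i) refl

≢⇒== : ∀ {n} {i j : Fin n} → i ≢ j → (i == j) ≡ false
≢⇒== {i = i} {j} = dec-false (i ≟ j)

==⇒≡ : ∀ {n} (i j : Fin n) → (i == j) ≡ true → i ≡ j
==⇒≡ i j p with i ≟ j
... | yes q = q

∧-true : ∀ a {b} → a ∧ b ≡ true → a ≡ true × b ≡ true
∧-true true p = refl , p

∨-true : ∀ a {b} → a ∨ b ≡ true → a ≡ true ⊎ b ≡ true
∨-true true p = inj₁ refl
∨-true false p = inj₂ p

∨-trueˡ : ∀ {a} b → a ≡ true → a ∨ b ≡ true
∨-trueˡ b refl = refl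

∨-trueʳ : ∀ a {b} → b ≡ true → a ∨ b ≡ true
∨-trueʳ true p = refl
∨-trueʳ false p = p

not-true : ∀ {a} → not a ≡ true → a ≡ false
not-true {false} p = refl

xor-false : ∀ {a b} → a xor b ≡ false → a ≡ b
xor-false {true} {true} p = refl
xor-false {false} {false} p = refl

xor-≡ : ∀ {a b} → a ≡ b → a xor b ≡ false
xor-≡ {a} refl = xor-same a

xor-true : ∀ {a b} → a xor b ≡ true → a ≢ b
xor-true {true} p refl = true≢false (sym p)
xor-true {false} p refl = true≢false (sym p)

sum-mono : ∀ {n} {f g : Fin n → ℕ} → (∀ i → f i ≤ g i) → sum f ≤ sum g
sum-mono {zero} h = z≤n
sum-mono {suc n} h = +-mono-≤ (h zero) (sum-mono (h ∘ suc))

sum-*ˡ : ∀ {n} c (f : Fin n → ℕ) → sum (λ i → c * f i) ≡ c * sum f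
sum-*ˡ {zero} c f = sym (*-zeroʳ c)
sum-*ˡ {suc n} c f = trans (cong (c * f zero +_) (sum-*ˡ c (f ∘ suc))) (sym (*-distribˡ-+ c (f zero) _))

sum-const : ∀ n c → sum {n} (λ _ → c) ≡ c * n
sum-const zero c = sym (*-zeroʳ c)
sum-const (suc n) c = trans (cong (c +_) (sum-const n c)) (sym (*-suc c n))

count : ∀ {n} → (Fin n → Bool) → ℕ
count P = sum (λ i → ⟦ P i ⟧)

⟦⟧≤1 : ∀ b → ⟦ b ⟧ ≤ 1
⟦⟧≤1 true = ≤-refl
⟦⟧≤1 false = z≤n

⟦⟧-mono : ∀ {a b} → (a ≡ true → b ≡ true) → ⟦ a ⟧ ≤ ⟦ b ⟧
⟦⟧-mono {false} h = z≤n
⟦⟧-mono {true} h rewrite h refl = ≤-refl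

count-mono : ∀ {n} {P Q : Fin n → Bool} → (∀ i → P i ≡ true → Q i ≡ true) → count P ≤ count Q
count-mono h = sum-mono (λ i → ⟦⟧-mono (h i))

count-cong : ∀ {n} {P Q : Fin n → Bool} → (∀ i → P i ≡ Q i) → count P ≡ count Q
count-cong h = sum-cong-≗ (λ i → cong ⟦_⟧ (h i))

sum-zero : ∀ {n} {f : Fin n → ℕ} → (∀ i → f i ≡ 0) → sum f ≡ 0
sum-zero {zero} h = refl
sum-zero {suc n} h rewrite h zero = sum-zero (h ∘ suc)

count-false : ∀ {n} (P : Fin n → Bool) → (∀ i → P i ≡ false) → count P ≡ 0
count-false P h = sum-zero (λ i → cong ⟦_⟧ (h i))

count-true : ∀ {n} → count {n} (λ _ → true) ≡ n
count-true {n} = trans (sum-const n 1) (*-identityˡ n)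

count-single : ∀ {n} (x : Fin n) → count (_== x) ≡ 1
count-single {suc n} zero = cong suc (count-false {n} (λ _ → false) (λ _ → refl))
count-single (suc x) = count-single x

infixl 6 _∖_
_∖_ : ∀ {n} → (Fin n → Bool) → Fin n → Fin n → Bool
(P ∖ x) i = P i ∧ not (i == x)

∖-⊆ : ∀ {n} (P : Fin n → Bool) {x i} → (P ∖ x) i ≡ true → P i ≡ true
∖-⊆ P {i = i} = proj₁ ∘ ∧-true (P i)

∖-≢ : ∀ {n} (P : Fin n → Bool) {x i} → (P ∖ x) i ≡ true → i ≢ x
∖-≢ P {x} p refl = true≢false (trans (sym p) (trans (cong (λ t → P x ∧ not t) (==-refl x)) (∧-zeroʳ (P x))))

∖-intro : ∀ {n} (P : Fin n → Bool) {x i} → P i ≡ true → i ≢ x → (P ∖ x) i ≡ true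
∖-intro P p q rewrite p | ≢⇒== q = refl

∖-self : ∀ {n} (P : Fin n → Bool) x → (P ∖ x) x ≡ false
∖-self P x rewrite ==-refl x = ∧-zeroʳ (P x)

count-∖ : ∀ {n} (P : Fin n → Bool) {x} → P x ≡ true → count P ≡ suc (count (P ∖ x))
count-∖ P {x} px = begin
  count P                                         ≡⟨ sum-cong-≗ pointwise ⟩
  sum (λ i → ⟦ i == x ⟧ + ⟦ (P ∖ x) i ⟧)           ≡⟨ ∑-distrib-+ (λ i → ⟦ i == x ⟧) (λ i → ⟦ (P ∖ x) i ⟧) ⟩
  count (_== x) + count (P ∖ x)                   ≡⟨ cong (_+ count (P ∖ x)) (count-single x) ⟩
  suc (count (P ∖ x))                             ∎
  where
  open ≡-Reasoning
  pointwise : ∀ i → ⟦ P i ⟧ ≡ ⟦ i == x ⟧ + ⟦ (P ∖ x) i ⟧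
  pointwise i with i ≟ x
  ... | yes refl rewrite px = refl
  ... | no _ = cong ⟦_⟧ (sym (∧-identityʳ (P i)))

count≡0 : ∀ {n} (P : Fin n → Bool) → count P ≡ 0 → ∀ i → P i ≡ false
count≡0 P h i with P i in eq
... | false = refl
... | true = contradiction (trans (sym (count-∖ P eq)) h) (λ ())

findTrue : ∀ {n} (P : Fin n → Bool) → (∃ λ i → P i ≡ true) ⊎ (∀ i → P i ≡ false)
findTrue P with any? (λ i → P i Bool.≟ true)
... | yes p = inj₁ p
... | no ¬p = inj₂ (λ i → ¬-not (λ q → ¬p (i , q)))

extract : ∀ {n} (P : Fin n → Bool) {k} → count P ≡ suc k → ∃ λ i → P i ≡ true × count (P ∖ i) ≡ k
extract P h with findTrue P
... | inj₁ (i , p) = i , p , suc-injective (trans (sym (count-∖ P p)) h)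
... | inj₂ q = contradiction (trans (sym (count-false P q)) h) (λ ())

count≥1 : ∀ {n} (P : Fin n → Bool) {i} → P i ≡ true → 1 ≤ count P
count≥1 P p rewrite count-∖ P p = s≤s z≤n

count≤1⇒unique : ∀ {n} (P : Fin n → Bool) → count P ≤ 1 → ∀ {i j} → P i ≡ true → P j ≡ true → i ≡ j
count≤1⇒unique P h {i} {j} p q with i ≟ j
... | yes r = r
... | no i≢j = contradiction h (<⇒≱ (subst (1 <_) (sym (count-∖ P p)) (s≤s (count≥1 (P ∖ i) (∖-intro P q (i≢j ∘ sym))))))

unique⇒count≤1 : ∀ {n} (P : Fin n → Bool) → (∀ {i j} → P i ≡ true → P j ≡ true → i ≡ j) → count P ≤ 1
unique⇒count≤1 P h with findTrue P
... | inj₂ q = subst (_≤ 1) (sym (count-false P q)) z≤n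
... | inj₁ (i , p) = subst (_≤ 1) (sym (trans (count-∖ P p) (cong suc (count-false (P ∖ i) none)))) ≤-refl
  where
  none : ∀ j → (P ∖ i) j ≡ false
  none j = ¬-not (λ q → ∖-≢ P q (h (∖-⊆ P q) p))

two-elements : ∀ {n} (P : Fin n → Bool) → count P ≡ 2 →
  ∃ λ f → ∃ λ g → f ≢ g × P f ≡ true × P g ≡ true × (∀ i → P i ≡ true → i ≡ f ⊎ i ≡ g)
two-elements P h with extract P h
... | f , pf , h₁ with extract (P ∖ f) h₁
... | g , pg , h₂ = f , g , (λ q → ∖-≢ P pg (sym q)) , pf , ∖-⊆ P pg , only
  where
  only : ∀ i → P i ≡ true → i ≡ f ⊎ i ≡ g
  only i p with i ≟ f | i ≟ g
  ... | yes q | _ = inj₁ q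
  ... | no _ | yes q = inj₂ q
  ... | no q | no r = ⊥-elim (true≢false (trans (sym (∖-intro (P ∖ f) (∖-intro P p q) r)) (count≡0 (P ∖ f ∖ g) h₂ i)))

count-pair : ∀ {n} (P : Fin n → Bool) {f g} → f ≢ g → P f ≡ true → P g ≡ true →
  (∀ i → P i ≡ true → i ≡ f ⊎ i ≡ g) → count P ≡ 2
count-pair P {f} {g} f≢g pf pg only =
  trans (count-∖ P pf) (cong suc (trans (count-∖ (P ∖ f) (∖-intro P pg (f≢g ∘ sym))) (cong suc (count-false (P ∖ f ∖ g) none))))
  where
  none : ∀ i → (P ∖ f ∖ g) i ≡ false
  none i = ¬-not (λ q → case only i (∖-⊆ P (∖-⊆ (P ∖ f) q)) of λ where
    (inj₁ r) → ∖-≢ P (∖-⊆ (P ∖ f) q) r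
    (inj₂ r) → ∖-≢ (P ∖ f) q r)

-- Averaging. It is applied to vertices, for one of small degree, and to the three forests, for one
-- that receives few edges.
light-element : ∀ {n} (W : Fin n → Bool) (g : Fin n → ℕ) c → sum (λ v → ⟦ W v ⟧ * g v) < suc c * count W →
  ∃ λ v → W v ≡ true × g v ≤ c
light-element W g c h with any? (λ v → (W v Bool.≟ true) ×-dec (g v ≤? c))
... | yes p = p
... | no ¬p = contradiction h (≤⇒≯ (subst (_≤ _) (sum-*ˡ (suc c) (λ v → ⟦ W v ⟧)) (sum-mono heavy)))
  where
  heavy : ∀ v → suc c * ⟦ W v ⟧ ≤ ⟦ W v ⟧ * g v
  heavy v with W v in eq
  ... | false rewrite *-zeroʳ c = z≤n
  ... | true rewrite *-identityʳ c | +-identityʳ (g v) = ≰⇒> (λ q → ¬p (v , eq , q))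

-- Sums modulo 2

xsum-zero : ∀ {n} {t : Fin n → Bool} → (∀ i → t i ≡ false) → xsum t ≡ false
xsum-zero {zero} h = refl
xsum-zero {suc n} h rewrite h zero = xsum-zero (h ∘ suc)

xsum-split : ∀ m {n} (t : Fin (m + n) → Bool) → xsum t ≡ xsum (λ i → t (i ↑ˡ n)) xor xsum (λ i → t (m ↑ʳ i))
xsum-split zero t = refl
xsum-split (suc m) {n} t = trans (cong (t zero xor_) (xsum-split m (t ∘ suc)))
  (sym (xor-assoc (t zero) (xsum (λ i → t (suc i ↑ˡ n))) _))

xsum-single : ∀ {n} (t : Fin n → Bool) f → (∀ e → e ≢ f → t e ≡ false) → xsum t ≡ t f
xsum-single {suc n} t f h = trans (xsum-remove {i = f} t)
  (trans (cong (t f xor_) (xsum-zero {t = λ i → t (punchIn f i)} (λ i → h (punchIn f i) (punchInᵢ≢i f i))))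
         (xor-identityʳ (t f)))

xsum-pair : ∀ {n} (t : Fin n → Bool) {f g} → f ≢ g → (∀ e → e ≢ f → e ≢ g → t e ≡ false) → xsum t ≡ t f xor t g
xsum-pair {n} t {f} {g} f≢g h = trans (xsum-cong split) (trans (xsum-distrib at-f at-g)
  (cong₂ _xor_ (trans (xsum-single at-f f off-f) on-f) (trans (xsum-single at-g g off-g) on-g)))
  where
  at-f at-g : Fin n → Bool
  at-f e = t e ∧ (e == f)
  at-g e = t e ∧ not (e == f)
  split : ∀ e → t e ≡ at-f e xor at-g e
  split e with t e | e == f
  ... | true | true = refl
  ... | true | false = refl
  ... | false | _ = refl
  off-f : ∀ e → e ≢ f → at-f e ≡ false
  off-f e p rewrite ≢⇒== p = ∧-zeroʳ (t e)
  on-f : at-f f ≡ t f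
  on-f rewrite ==-refl f = ∧-identityʳ (t f)
  on-g : at-g g ≡ t g
  on-g rewrite ≢⇒== (f≢g ∘ sym) = ∧-identityʳ (t g)
  off-g : ∀ e → e ≢ g → at-g e ≡ false
  off-g e p with e ≟ f
  ... | yes refl = ∧-zeroʳ (t e)
  ... | no q rewrite h e q p = refl

-- For linear combinations of inequalities: the hypotheses are added up to `p ≤ q`, and the terms
-- `k` common to both sides cancel.
linear : ∀ k {a b p q} → p ≤ q → k + a ≤ p → q ≤ k + b → a ≤ b
linear k pq e₁ e₂ = +-cancelˡ-≤ k _ _ (≤-trans e₁ (≤-trans pq e₂))

Surj : ∀ {N p} → (Fin N → Fin p) → Set
Surj f = ∀ i → ∃ λ z → f z ≡ i

-- The quotient of a labelling by one identification, renumbered so that the number of labels drops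
-- by exactly one. Components and faces are both counted through such labellings.
record Merged {N p} (lab : Fin N → Fin p) (x y : Fin N) : Set where
  field
    {p′}    : ℕ
    drop    : p ≡ suc p′
    lab′    : Fin N → Fin p′
    surj    : Surj lab′
    glued   : lab′ x ≡ lab′ y
    respect : ∀ {a b} → lab a ≡ lab b → lab′ a ≡ lab′ b

merge : ∀ {N p} (lab : Fin N → Fin p) → Surj lab → ∀ x y → lab x ≢ lab y → Merged lab x y
merge {p = zero} lab s x y ne with lab x
... | ()
merge {N} {suc p} lab s x y ne = record
  { drop = refl ; lab′ = λ z → punchOut (avoid z) ; surj = surj′
  ; glued = punchOut-cong (lab x) (trans (moved x refl) (sym (fixed y (ne ∘ sym))))
  ; respect = λ {a} {b} q → punchOut-cong (lab x) (cong new q) }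
  where
  new : Fin (suc p) → Fin (suc p)
  new i with i ≟ lab x
  ... | yes _ = lab y
  ... | no _ = i
  moved : ∀ z → lab z ≡ lab x → new (lab z) ≡ lab y
  moved z q with lab z ≟ lab x
  ... | yes _ = refl
  ... | no r = ⊥-elim (r q)
  fixed : ∀ z → lab z ≢ lab x → new (lab z) ≡ lab z
  fixed z q with lab z ≟ lab x
  ... | yes r = ⊥-elim (q r)
  ... | no _ = refl
  avoid′ : ∀ i → lab x ≢ new i
  avoid′ i with i ≟ lab x
  ... | yes _ = ne
  ... | no r = r ∘ sym
  avoid : ∀ z → lab x ≢ new (lab z)
  avoid z = avoid′ (lab z)
  surj′ : ∀ i → ∃ λ z → punchOut (avoid z) ≡ i
  surj′ i with s (punchIn (lab x) i)
  ... | z , q = z , trans (punchOut-cong (lab x) {i≢k = punchInᵢ≢i (lab x) i ∘ sym}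
                      (trans (fixed z (λ r → punchInᵢ≢i (lab x) i (trans (sym q) r))) q))
                    (punchOut-punchIn (lab x))

-- Each element identified with `y₀` costs at most one label. In its use `Y` lacks `y₀`, so that
-- `k + 1` vertices become one.
contract : ∀ {n} k (Y : Fin n → Bool) → count Y ≡ k → ∀ y₀ →
  ∃ λ p → Σ[ lab ∈ (Fin n → Fin p) ] Surj lab × (∀ z → Y z ≡ true → lab z ≡ lab y₀) × n ≤ p + k
contract zero Y c y₀ = _ , id , (λ i → i , refl) ,
  (λ z q → contradiction (trans (sym q) (count≡0 Y c z)) true≢false) , m≤m+n _ 0
contract {n} (suc k) Y c y₀ with extract Y c
... | z , yz , c′ with contract k (Y ∖ z) c′ y₀
... | p , lab , s , flat , bound with lab z ≟ lab y₀
... | yes q = p , lab , s , flat′ , ≤-trans bound (+-monoʳ-≤ p (n≤1+n k))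
  where
  flat′ : ∀ a → Y a ≡ true → lab a ≡ lab y₀
  flat′ a ya with a ≟ z
  ... | yes refl = q
  ... | no r = flat a (∖-intro Y ya r)
... | no q with merge lab s z y₀ q
... | record { p′ = p′ ; drop = refl ; lab′ = lab′ ; surj = surj ; glued = glued ; respect = respect } =
  p′ , lab′ , surj , flat′ , subst (n ≤_) (sym (+-suc p′ k)) bound
  where
  flat′ : ∀ a → Y a ≡ true → lab′ a ≡ lab′ y₀
  flat′ a ya with a ≟ z
  ... | yes refl = glued
  ... | no r = respect (flat a (∖-intro Y ya r))

-- Plane maps

record PlaneMap (n E F : ℕ) : Set where
  field
    u v   : Fin E → Fin n
    l r   : Fin E → Fin F
    u≢v   : ∀ e → u e ≢ v e
    euler : n + F ≡ E + 2

  Inc : Fin E → Fin n → Set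
  Inc e z = u e ≡ z ⊎ v e ≡ z

  cut : (Fin F → Bool) → Fin E → Bool
  cut R e = R (l e) xor R (r e)

  crossing : (Fin n → Bool) → Fin E → Bool
  crossing X e = X (u e) xor X (v e)

  field
    -- The boundary of a set of faces has even degree everywhere, hence meets each vertex cut in an even number of edges.
    orth  : ∀ X R → xsum (λ e → crossing X e ∧ cut R e) ≡ false
    -- Consecutive faces around `z` are separated by an edge at `z`; if none of these is in the
    -- boundary of `R`, then `R` contains all faces around `z` or none.
    loc   : ∀ R z → (∀ e → Inc e z → cut R e ≡ false) → ∀ {e e′} → Inc e z → Inc e′ z → R (l e) ≡ R (l e′)
    -- Connectivity of the map and of its dual is stated through labellings constant along edges,
    -- the form in which the counting of components and faces consumes it.
    conn  : ∀ {p} (X : Fin n → Fin p) → (∀ e → X (u e) ≡ X (v e)) → ∀ a b → X a ≡ X b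
    dconn : ∀ R → (∀ e → cut R e ≡ false) → ∀ s t → R s ≡ R t

  Par : Fin E → Fin E → Set
  Par e e′ = (u e ≡ u e′ × v e ≡ v e′) ⊎ (u e ≡ v e′ × v e ≡ u e′)

  Par-sym : ∀ {e e′} → Par e e′ → Par e′ e
  Par-sym (inj₁ (p , q)) = inj₁ (sym p , sym q)
  Par-sym (inj₂ (p , q)) = inj₂ (sym q , sym p)

  par-of-ends : ∀ {e f} → Inc f (u e) → Inc f (v e) → Par e f
  par-of-ends {e} (inj₁ p) (inj₁ q) = ⊥-elim (u≢v e (trans (sym p) q))
  par-of-ends (inj₁ p) (inj₂ q) = inj₁ (sym p , sym q)
  par-of-ends (inj₂ p) (inj₁ q) = inj₂ (sym p , sym q)
  par-of-ends {e} (inj₂ p) (inj₂ q) = ⊥-elim (u≢v e (trans (sym p) q))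

  Par? : ∀ e e′ → Dec (Par e e′)
  Par? e e′ = ((u e ≟ u e′) ×-dec (v e ≟ v e′)) ⊎-dec ((u e ≟ v e′) ×-dec (v e ≟ u e′))

  Simple : (Fin E → Bool) → Set
  Simple K = ∀ {e e′} → K e ≡ true → K e′ ≡ true → Par e e′ → e ≡ e′

  Proper : (Fin F → Bool) → Set
  Proper R = (∃ λ s → R s ≡ true) × (∃ λ t → R t ≡ false)

  -- Each edge outside K is either contracted in the primal or merged in the dual, but not both, by orthogonality.
  faces-step : ∀ k (Q : Fin E → Bool) → count Q ≡ k → ∀ {p} (lab : Fin n → Fin p) → Surj lab →
    (∀ e → Q e ≡ false → lab (u e) ≡ lab (v e)) →
    ∃ λ c → Σ[ lab′ ∈ (Fin F → Fin c) ] Surj lab′ × (∀ e → Q e ≡ true → lab′ (l e) ≡ lab′ (r e)) × F + p ≤ c + k + 1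
  -- No edge is left to delete: the labelling of the vertices is constant by connectivity, so `p` is
  -- at most one, and all faces stay distinct.
  faces-step zero Q cQ {p} lab s closed = F , id , (λ i → i , refl) ,
    (λ e q → contradiction (trans (sym q) (count≡0 Q cQ e)) true≢false) ,
    subst (F + p ≤_) (cong (_+ 1) (sym (+-identityʳ F))) (+-monoʳ-≤ F (p≤1 lab s const))
    where
    const : ∀ a b → lab a ≡ lab b
    const = conn lab (λ e → closed e (count≡0 Q cQ e))
    p≤1 : ∀ {p} (lab : Fin n → Fin p) → Surj lab → (∀ a b → lab a ≡ lab b) → p ≤ 1
    p≤1 {zero} lab s h = z≤n
    p≤1 {suc zero} lab s h = s≤s z≤n
    p≤1 {suc (suc p)} lab s h with s zero | s (suc zero)
    ... | a , q | b , q′ = contradiction (trans (sym q) (trans (h a b) q′)) (λ ())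
  faces-step (suc k) Q cQ {p} lab s closed with extract Q cQ
  ... | e , qe , cQ′ with lab (u e) ≟ lab (v e)
  ... | yes same with faces-step k (Q ∖ e) cQ′ lab s closed′
    where
    closed′ : ∀ a → (Q ∖ e) a ≡ false → lab (u a) ≡ lab (v a)
    closed′ a q with a ≟ e
    ... | yes refl = same
    ... | no _ = closed a (trans (sym (∧-identityʳ (Q a))) q)
  ... | c , lab′ , s′ , flat , bound with lab′ (l e) ≟ lab′ (r e)
  ... | yes q = c , lab′ , s′ , flat′ , ≤-trans bound (+-monoˡ-≤ 1 (+-monoʳ-≤ c (n≤1+n k)))
    where
    flat′ : ∀ a → Q a ≡ true → lab′ (l a) ≡ lab′ (r a)
    flat′ a qa with a ≟ e
    ... | yes refl = q
    ... | no ne = flat a (∖-intro Q qa ne)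
  ... | no q with merge lab′ s′ (l e) (r e) q
  ... | record { p′ = c″ ; drop = refl ; lab′ = lab″ ; surj = surj ; glued = glued ; respect = respect } =
    c″ , lab″ , surj , flat′ , subst (λ t → F + p ≤ t + 1) (sym (+-suc c″ k)) bound
    where
    flat′ : ∀ a → Q a ≡ true → lab″ (l a) ≡ lab″ (r a)
    flat′ a qa with a ≟ e
    ... | yes refl = glued
    ... | no ne = respect (flat a (∖-intro Q qa ne))
  faces-step (suc k) Q cQ {p} lab s closed | e , qe , cQ′ | no differ with merge lab s (u e) (v e) differ
  ... | record { p′ = p′ ; drop = refl ; lab′ = lab₁ ; surj = s₁ ; glued = glued ; respect = respect }
    with faces-step k (Q ∖ e) cQ′ lab₁ s₁ closed′
    where
    closed′ : ∀ a → (Q ∖ e) a ≡ false → lab₁ (u a) ≡ lab₁ (v a)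
    closed′ a q with a ≟ e
    ... | yes refl = glued
    ... | no _ = respect (closed a (trans (sym (∧-identityʳ (Q a))) q))
  ... | c , lab′ , s′ , flat , bound = c , lab′ , s′ , flat′ ,
        subst₂ _≤_ (sym (+-suc F p′)) (cong (_+ 1) (sym (+-suc c k))) (s≤s bound)
    where
    -- An edge outside `Q` does not cross `X`, since `lab` agrees on its ends; an edge of `Q` other
    -- than `e` is not in the boundary of `R`, since its faces are merged. So `e` is the only
    -- possible common edge, and evenness excludes it: its faces are merged already.
    X : Fin n → Bool
    X z = lab z == lab (u e)
    R : Fin F → Bool
    R t = lab′ t == lab′ (l e)
    off : ∀ a → a ≢ e → crossing X a ∧ cut R a ≡ false
    off a ne with Q a in qa
    ... | false rewrite closed a qa = cong (_∧ cut R a) (xor-same (X (v a)))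
    ... | true rewrite flat a (∖-intro Q qa ne) = trans (cong (crossing X a ∧_) (xor-same (R (r a)))) (∧-zeroʳ (crossing X a))
    at-e : crossing X e ∧ cut R e ≡ false
    at-e = trans (sym (xsum-single (λ a → crossing X a ∧ cut R a) e off)) (orth X R)
    same′ : lab′ (l e) ≡ lab′ (r e)
    same′ with lab′ (r e) ≟ lab′ (l e)
    ... | yes q = sym q
    ... | no q = contradiction (trans (sym at-e)
            (cong₂ _∧_ (cong₂ _xor_ (==-refl (lab (u e))) (≢⇒== (differ ∘ sym)))
                       (cong₂ _xor_ (==-refl (lab′ (l e))) (≢⇒== q)))) (λ ())
    flat′ : ∀ a → Q a ≡ true → lab′ (l a) ≡ lab′ (r a)
    flat′ a qa with a ≟ e
    ... | yes refl = same′
    ... | no ne = flat a (∖-intro Q qa ne)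

  -- Euler's inequality V - E + F ≥ 2 for the subgraph with vertices `Y` and edges `K`, the labels
  -- being its faces. It follows from `faces-step` with `Y` contracted to one class and all other
  -- vertices left single.
  faces : ∀ (K : Fin E → Bool) (Y : Fin n → Bool) → (∀ e → K e ≡ true → Y (u e) ≡ true × Y (v e) ≡ true) →
    ∀ y₀ → Y y₀ ≡ true →
    ∃ λ c → Σ[ lab ∈ (Fin F → Fin c) ] Surj lab × (∀ e → K e ≡ false → lab (l e) ≡ lab (r e)) ×
      count K + 2 ≤ c + count Y
  faces K Y ends y₀ yy with contract (count (Y ∖ y₀)) (Y ∖ y₀) refl y₀
  ... | p , lab , s , flat , n≤ with faces-step (count (not ∘ K)) (not ∘ K) refl lab s closed
    where
    closed : ∀ e → not (K e) ≡ false → lab (u e) ≡ lab (v e)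
    closed e q with K e in ke
    ... | true = trans (at (u e) (proj₁ (ends e ke))) (sym (at (v e) (proj₂ (ends e ke))))
      where
      at : ∀ z → Y z ≡ true → lab z ≡ lab y₀
      at z yz with z ≟ y₀
      ... | yes refl = refl
      ... | no ne = flat z (∖-intro Y yz ne)
  ... | c , lab′ , s′ , flat′ , bound = c , lab′ , s′ , (λ e q → flat′ e (cong not q)) ,
      subst (λ t → count K + 2 ≤ c + t) (sym (count-∖ Y yy))
        (linear (p + count (not ∘ K)) (+-mono-≤ n≤ bound)
          (≤-reflexive (trans (arith₁ p (count (not ∘ K)) (count K))
            (trans (cong (λ t → p + (t + 2)) split) (trans (cong (p +_) (sym euler)) (arith₂ n p F)))))
          (≤-reflexive (arith₃ p (count (not ∘ K)) c (count (Y ∖ y₀)))))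
    where
    split : count (not ∘ K) + count K ≡ E
    split = trans (sym (∑-distrib-+ (λ e → ⟦ not (K e) ⟧) (λ e → ⟦ K e ⟧)))
      (trans (sum-cong-≗ one) count-true)
      where
      one : ∀ e → ⟦ not (K e) ⟧ + ⟦ K e ⟧ ≡ 1
      one e with K e
      ... | true = refl
      ... | false = refl
    arith₁ : ∀ p q k → p + q + (k + 2) ≡ p + (q + k + 2)
    arith₁ = solve-∀
    arith₂ : ∀ n p F → p + (n + F) ≡ n + (F + p)
    arith₂ = solve-∀
    arith₃ : ∀ p q c y → p + y + (c + q + 1) ≡ p + q + (c + suc y)
    arith₃ = solve-∀

  -- Boundaries of face sets

  cut-≢ : ∀ R {e} → cut R e ≡ true → R (l e) ≢ R (r e)
  cut-≢ R = xor-true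

  uncut : ∀ R {e} → cut R e ≡ false → R (l e) ≡ R (r e)
  uncut R = xor-false

  proper-of-cut : ∀ R {e} → cut R e ≡ true → Proper R
  proper-of-cut R {e} p with R (l e) in pl | R (r e) in pr
  ... | true | false = (l e , pl) , (r e , pr)
  ... | false | true = (r e , pr) , (l e , pl)

  -- In `orth` only `f` and `g` can contribute, so their contributions are equal.
  orth-pair : ∀ R {f g} → f ≢ g → (∀ e → cut R e ≡ true → e ≡ f ⊎ e ≡ g) → cut R f ≡ true → cut R g ≡ true →
    ∀ X → crossing X f ≡ crossing X g
  orth-pair R {f} {g} f≢g only cf cg X = xor-false (trans (cong₂ _xor_ (simplify f cf) (simplify g cg))
    (trans (sym (xsum-pair (λ e → crossing X e ∧ cut R e) f≢g off)) (orth X R)))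
    where
    simplify : ∀ e → cut R e ≡ true → crossing X e ≡ crossing X e ∧ cut R e
    simplify e c rewrite c = sym (∧-identityʳ (crossing X e))
    off : ∀ e → e ≢ f → e ≢ g → crossing X e ∧ cut R e ≡ false
    off e p q with cut R e in ce
    ... | false = ∧-zeroʳ (crossing X e)
    ... | true = ⊥-elim ([ p , q ]′ (only e ce))

  crossing-own : ∀ e → crossing (_== u e) e ≡ true
  crossing-own e rewrite ==-refl (u e) | ≢⇒== (u≢v e ∘ sym) = refl

  crossing-own′ : ∀ e → crossing (_== v e) e ≡ true
  crossing-own′ e rewrite ==-refl (v e) | ≢⇒== (u≢v e) = refl

  crossing-end : ∀ z e → crossing (_== z) e ≡ true → Inc e z
  crossing-end z e p with u e ≟ z | v e ≟ z
  ... | yes q | _ = inj₁ q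
  ... | no _ | yes q = inj₂ q

  -- Each end of `f`, as a one-element vertex set, is crossed by `f` and hence by `g`.
  parallel-of-cut : ∀ R {f g} → f ≢ g → (∀ e → cut R e ≡ true → e ≡ f ⊎ e ≡ g) → cut R f ≡ true → cut R g ≡ true → Par f g
  parallel-of-cut R {f} {g} f≢g only cf cg = par-of-ends
    (crossing-end (u f) g (trans (sym (orth-pair R f≢g only cf cg (_== u f))) (crossing-own f)))
    (crossing-end (v f) g (trans (sym (orth-pair R f≢g only cf cg (_== v f))) (crossing-own′ f)))

  -- The dual of a bridge is a loop: the cut around one end of `f` would meet the boundary of `R` in
  -- `f` alone, an odd number of edges.
  no-single-cut : ∀ R {f} → (∀ e → cut R e ≡ true → e ≡ f) → cut R f ≢ true
  no-single-cut R {f} only cf = true≢false (trans (sym at-f) (trans (sym (xsum-single (λ e → crossing X e ∧ cut R e) f off)) (orth X R)))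
    where
    X : Fin n → Bool
    X = _== u f
    at-f : crossing X f ∧ cut R f ≡ true
    at-f rewrite cf = trans (∧-identityʳ (crossing X f)) (crossing-own f)
    off : ∀ e → e ≢ f → crossing X e ∧ cut R e ≡ false
    off e p with cut R e in ce
    ... | false = ∧-zeroʳ (crossing X e)
    ... | true = ⊥-elim (p (only e ce))

  cuts≥2 : ∀ R → Proper R → 2 ≤ count (cut R)
  cuts≥2 R ((s , ps) , (t , pt)) with count (cut R) in c
  ... | suc (suc k) = s≤s (s≤s z≤n)
  ... | zero = contradiction (trans (sym ps) (trans (dconn R (count≡0 (cut R) c) s t) pt)) true≢false
  ... | suc zero with extract (cut R) c
  ...   | f , cf , c′ = ⊥-elim (no-single-cut R (λ e ce → count≤1⇒unique (cut R) (≤-reflexive c) ce cf) cf)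

  both-cut : ∀ R → Proper R → ∀ {f g} → (∀ e → cut R e ≡ true → e ≡ f ⊎ e ≡ g) → cut R f ≡ true × cut R g ≡ true
  both-cut R pr {f} {g} only = side f g only , side g f (λ e ce → Sum.swap (only e ce))
    where
    side : ∀ f g → (∀ e → cut R e ≡ true → e ≡ f ⊎ e ≡ g) → cut R f ≡ true
    side f g only with cut R f in cf
    ... | true = refl
    ... | false = contradiction (cuts≥2 R pr) (≤⇒≯ (unique⇒count≤1 (cut R) (λ p q → trans (to-g p) (sym (to-g q)))))
      where
      to-g : ∀ {e} → cut R e ≡ true → e ≡ g
      to-g {e} ce with only e ce
      ... | inj₁ refl = contradiction (trans (sym ce) cf) true≢false
      ... | inj₂ q = q

  -- A 2-cycle together with one of its sides, given as a set of faces. The complement of `R`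
  -- satisfies the same conditions, so neither side is distinguished as the interior.
  record Digon (R : Fin F → Bool) (f g : Fin E) : Set where
    field
      f≢g  : f ≢ g
      cutf : cut R f ≡ true
      cutg : cut R g ≡ true
      only : ∀ e → cut R e ≡ true → e ≡ f ⊎ e ≡ g

    proper : Proper R
    proper = proper-of-cut R cutf

    par : Par f g
    par = parallel-of-cut R f≢g only cutf cutg

    cuts : count (cut R) ≡ 2
    cuts = count-pair (cut R) f≢g cutf cutg only

  digon-of-count : ∀ R → count (cut R) ≡ 2 → ∃ λ f → ∃ λ g → Digon R f g
  digon-of-count R c with two-elements (cut R) c
  ... | f , g , f≢g , cf , cg , only = f , g , record { f≢g = f≢g ; cutf = cf ; cutg = cg ; only = only }

  -- Euler's inequality for two edges on two vertices gives at least two faces. One of them serves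
  -- as `R`: its boundary lies in the pair, and then is the whole pair by `both-cut`.
  digon-of-parallel : ∀ {f g} → Par f g → f ≢ g → ∃ λ R → Digon R f g
  digon-of-parallel {f} {g} par f≢g with faces K Y K-ends (u f) yu
    where
    K : Fin E → Bool
    K e = (e == f) ∨ (e == g)
    Y : Fin n → Bool
    Y z = (z == u f) ∨ (z == v f)
    yu : Y (u f) ≡ true
    yu rewrite ==-refl (u f) = refl
    yv : Y (v f) ≡ true
    yv rewrite ==-refl (v f) = ∨-trueʳ (v f == u f) refl
    K-ends : ∀ e → K e ≡ true → Y (u e) ≡ true × Y (v e) ≡ true
    K-ends e k with ∨-true (e == f) k
    ... | inj₁ q rewrite ==⇒≡ e f q = yu , yv
    K-ends e k | inj₂ q rewrite ==⇒≡ e g q = case par of λ where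
      (inj₁ (p , p′)) → trans (cong Y (sym p)) yu , trans (cong Y (sym p′)) yv
      (inj₂ (p , p′)) → trans (cong Y (sym p′)) yv , trans (cong Y (sym p)) yu
  ... | c , lab , s , flat , bound = region c lab s flat
          (+-cancelʳ-≤ 2 2 c (subst₂ (λ a b → a + 2 ≤ c + b) countK countY bound))
    where
    countK : count (λ e → (e == f) ∨ (e == g)) ≡ 2
    countK = count-pair (λ e → (e == f) ∨ (e == g)) f≢g (∨-trueˡ (f == g) (==-refl f)) (∨-trueʳ (g == f) (==-refl g))
      (λ i k → Sum.map (==⇒≡ i f) (==⇒≡ i g) (∨-true (i == f) k))
    countY : count (λ z → (z == u f) ∨ (z == v f)) ≡ 2
    countY = count-pair (λ z → (z == u f) ∨ (z == v f)) (u≢v f) (∨-trueˡ (u f == v f) (==-refl (u f))) (∨-trueʳ (v f == u f) (==-refl (v f)))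
      (λ i k → Sum.map (==⇒≡ i (u f)) (==⇒≡ i (v f)) (∨-true (i == u f) k))
    region : ∀ c (lab : Fin F → Fin c) → Surj lab → (∀ e → (e == f) ∨ (e == g) ≡ false → lab (l e) ≡ lab (r e)) → 2 ≤ c →
      ∃ λ R → Digon R f g
    region (suc (suc c)) lab s flat (s≤s (s≤s _)) = R , record { f≢g = f≢g ; cutf = proj₁ both ; cutg = proj₂ both ; only = only }
      where
      R : Fin F → Bool
      R t = lab t == zero
      prop : Proper R
      prop with s zero | s (suc zero)
      ... | a , p | b , q = (a , cong (_== zero) p) , (b , cong (_== zero) q)
      only : ∀ e → cut R e ≡ true → e ≡ f ⊎ e ≡ g
      only e ce with (e == f) ∨ (e == g) in k
      ... | true = Sum.map (==⇒≡ e f) (==⇒≡ e g) (∨-true (e == f) k)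
      ... | false = contradiction (cong (_== zero) (flat e k)) (cut-≢ R ce)
      both : cut R f ≡ true × cut R g ≡ true
      both = both-cut R prop only

  -- Every face of a simple subgraph with at least two faces has at least three edges.
  simple-bound : ∀ (K : Fin E → Bool) (Y : Fin n → Bool) → Simple K → (∀ e → K e ≡ true → Y (u e) ≡ true × Y (v e) ≡ true) →
    3 ≤ count Y → count K + 6 ≤ 3 * count Y
  simple-bound K Y simple ends y≥3 with findTrue Y
  ... | inj₂ none = contradiction (subst (3 ≤_) (count-false Y none) y≥3) (λ ())
  ... | inj₁ (y₀ , yy) with faces K Y ends y₀ yy
  ... | c , lab , s , flat , bound with 2 ≤? c
  -- With at most one face there are fewer edges than vertices, and `3 ≤ count Y` does the rest.
  ... | no c<2 = few (count K) (count Y) (≤-trans bound (+-monoˡ-≤ (count Y) (≤-pred (≰⇒> c<2)))) y≥3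
    where
    few : ∀ k y → k + 2 ≤ 1 + y → 3 ≤ y → k + 6 ≤ 3 * y
    few k y p q = linear 1 (+-mono-≤ p (+-mono-≤ q q)) (≤-trans (m≤m+n _ 1) (≤-reflexive (lhs k))) (≤-reflexive (rhs y))
      where
      lhs : ∀ k → 1 + (k + 6) + 1 ≡ k + 2 + (3 + 3)
      lhs = solve-∀
      rhs : ∀ y → 1 + y + (y + y) ≡ 1 + 3 * y
      rhs = solve-∀
  ... | yes c≥2 = many (count K) (count Y) c bound (≤-trans triples incidences)
    where
    many : ∀ k y c → k + 2 ≤ c + y → 3 * c ≤ 2 * k → k + 6 ≤ 3 * y
    many k y c p q = linear (2 * k + 3 * c) (+-mono-≤ (*-monoʳ-≤ 3 p) q) (≤-reflexive (lhs k c)) (≤-reflexive (rhs k c y))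
      where
      lhs : ∀ k c → 2 * k + 3 * c + (k + 6) ≡ 3 * (k + 2) + 3 * c
      lhs = solve-∀
      rhs : ∀ k c y → 3 * (c + y) + 2 * k ≡ 2 * k + 3 * c + 3 * y
      rhs = solve-∀
    R : Fin c → Fin F → Bool
    R i t = lab t == i
    another : ∀ {c} → 2 ≤ c → (i : Fin c) → ∃ λ j → j ≢ i
    another {suc zero} (s≤s ()) _
    another {suc (suc c)} _ zero = suc zero , λ ()
    another {suc (suc c)} _ (suc i) = zero , λ ()
    proper : ∀ i → Proper (R i)
    proper i with s i | another c≥2 i
    ... | a , p | j , j≢i with s j
    ... | b , q = (a , trans (cong (_== i) p) (==-refl i)) , (b , trans (cong (_== i) q) (≢⇒== j≢i))
    inK : ∀ i e → cut (R i) e ≡ true → K e ≡ true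
    inK i e ce with K e in k
    ... | true = refl
    ... | false = contradiction (cong (_== i) (flat e k)) (cut-≢ (R i) ce)
    -- Two boundary edges would be parallel, against simplicity.
    three : ∀ i → 3 ≤ count (cut (R i))
    three i = ≤∧≢⇒< (cuts≥2 (R i) (proper i)) (λ q → case digon-of-count (R i) (sym q) of λ where
      (f , g , d) → Digon.f≢g d (simple (inK i f (Digon.cutf d)) (inK i g (Digon.cutg d)) (Digon.par d)))
    triples : 3 * c ≤ sum (λ i → sum (λ e → ⟦ cut (R i) e ⟧))
    triples = ≤-trans (≤-reflexive (sym (sum-const c 3))) (sum-mono three)
    ⟦xor⟧≤ : ∀ a b → ⟦ a xor b ⟧ ≤ ⟦ a ⟧ + ⟦ b ⟧
    ⟦xor⟧≤ true true = z≤n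
    ⟦xor⟧≤ true false = ≤-refl
    ⟦xor⟧≤ false b = ≤-refl
    label : ∀ (j : Fin c) → sum (λ i → ⟦ j == i ⟧) ≡ 1
    label j = trans (count-cong flip) (count-single j)
      where
      flip : ∀ i → (j == i) ≡ (i == j)
      flip i with j ≟ i
      ... | yes refl = sym (==-refl j)
      ... | no q = sym (≢⇒== (q ∘ sym))
    twice : ∀ e → sum (λ i → ⟦ cut (R i) e ⟧) ≤ 2 * ⟦ K e ⟧
    twice e with K e in k
    ... | false = ≤-reflexive (count-false (λ i → cut (R i) e) (λ i → xor-≡ (cong (_== i) (flat e k))))
    ... | true = ≤-trans (sum-mono (λ i → ⟦xor⟧≤ (R i (l e)) (R i (r e))))
      (≤-reflexive (trans (∑-distrib-+ (λ i → ⟦ R i (l e) ⟧) (λ i → ⟦ R i (r e) ⟧)) (cong₂ _+_ (label (lab (l e))) (label (lab (r e))))))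
    incidences : sum (λ i → sum (λ e → ⟦ cut (R i) e ⟧)) ≤ 2 * count K
    incidences = ≤-trans (≤-reflexive (∑-comm (λ i e → ⟦ cut (R i) e ⟧)))
      (≤-trans (sum-mono twice) (≤-reflexive (sum-*ˡ 2 (λ e → ⟦ K e ⟧))))

-- Digons

module Digons {n E F : ℕ} (M : PlaneMap n E F) where
  open PlaneMap M

  -- Holds edge by edge; the only loss is at edges between the two differences of `R` and `S`.
  submodular : ∀ R S → count (cut (λ t → R t ∧ S t)) + count (cut (λ t → R t ∨ S t)) ≤ count (cut R) + count (cut S)
  submodular R S = subst₂ _≤_ (∑-distrib-+ (λ e → ⟦ cut (λ t → R t ∧ S t) e ⟧) (λ e → ⟦ cut (λ t → R t ∨ S t) e ⟧))
      (∑-distrib-+ (λ e → ⟦ cut R e ⟧) (λ e → ⟦ cut S e ⟧))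
      (sum-mono (λ e → pointwise (R (l e)) (R (r e)) (S (l e)) (S (r e))))
    where
    pointwise : ∀ a b c d → ⟦ (a ∧ c) xor (b ∧ d) ⟧ + ⟦ (a ∨ c) xor (b ∨ d) ⟧ ≤ ⟦ a xor b ⟧ + ⟦ c xor d ⟧
    pointwise true true true true = ≤-refl
    pointwise true true true false = ≤-refl
    pointwise true true false true = ≤-refl
    pointwise true true false false = ≤-refl
    pointwise true false true true = ≤-refl
    pointwise true false true false = ≤-refl
    pointwise true false false true = z≤n
    pointwise true false false false = ≤-refl
    pointwise false true true true = ≤-refl
    pointwise false true true false = z≤n
    pointwise false true false true = ≤-refl
    pointwise false true false false = ≤-refl
    pointwise false false true true = ≤-refl
    pointwise false false true false = ≤-refl
    pointwise false false false true = ≤-refl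
    pointwise false false false false = ≤-refl

  -- The two faces at a boundary edge, renamed so that `x` is the one in `R`. This spares a case
  -- distinction between left and right in every later argument.
  record Sides (R : Fin F → Bool) (e : Fin E) : Set where
    field
      x y    : Fin F
      Rx     : R x ≡ true
      Ry     : R y ≡ false
      cut-xy : ∀ (S : Fin F → Bool) → cut S e ≡ S x xor S y
      to     : ∀ (S : Fin F → Bool) → S (l e) ≡ true → S (r e) ≡ true → S x ≡ true × S y ≡ true
      from   : ∀ (S : Fin F → Bool) → S x ≡ true → S y ≡ true → S (l e) ≡ true × S (r e) ≡ true

  sides : ∀ R {e} → cut R e ≡ true → Sides R e
  sides R {e} p with R (l e) in pl | R (r e) in pr
  ... | true | false = record { x = l e ; y = r e ; Rx = pl ; Ry = pr ; cut-xy = λ S → refl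
                              ; to = λ S → _,_ ; from = λ S → _,_ }
  ... | false | true = record { x = r e ; y = l e ; Rx = pr ; Ry = pl
                              ; cut-xy = λ S → xor-comm (S (l e)) (S (r e))
                              ; to = λ S a b → b , a ; from = λ S a b → b , a }

  inside : (Fin E → Bool) → (Fin F → Bool) → Fin E → Bool
  inside H R e = H e ∧ (R (l e) ∧ R (r e))

  inside-elim : ∀ H R {e} → inside H R e ≡ true → H e ≡ true × R (l e) ≡ true × R (r e) ≡ true
  inside-elim H R {e} p with ∧-true (H e) p
  ... | h , q with ∧-true (R (l e)) q
  ... | a , b = h , a , b

  inside-intro : ∀ H R {e} → H e ≡ true → R (l e) ≡ true → R (r e) ≡ true → inside H R e ≡ true
  inside-intro H R h a b rewrite h | a | b = refl

  inside-uncut : ∀ H R {e} → inside H R e ≡ true → cut R e ≡ false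
  inside-uncut H R {e} p with inside-elim H R {e} p
  ... | _ , a , b rewrite a | b = refl

  infix 4 _⊆_
  _⊆_ : ∀ {k} → (Fin k → Bool) → (Fin k → Bool) → Set
  P ⊆ Q = ∀ e → P e ≡ true → Q e ≡ true

  avoiding : ∀ S t → ∃ λ S′ → S′ t ≡ false × (∀ e → cut S′ e ≡ cut S e)
  avoiding S t with S t in st
  ... | false = S , st , λ e → refl
  ... | true = not ∘ S , cong not st , λ e → xor-annihilates-not (S (l e)) (S (r e))

  -- The parallel pair bounds a digon `S`, chosen on the side that avoids a face `t` outside `R`.
  -- Then both the intersection and the union of `R` and `S` are proper, so each has at least two
  -- boundary edges; by submodularity the sum is at most four, so the intersection is a digon.
  uncross : ∀ {H R f g} → Digon R f g → cut R ⊆ H → ∀ {e e′} → inside H R e ≡ true → H e′ ≡ true → Par e e′ → e ≢ e′ →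
    ∃ λ R′ → ∃ λ f′ → ∃ λ g′ → Digon R′ f′ g′ × cut R′ ⊆ H × count R′ < count R
  uncross {H} {R} {f} {g} d cR {e} {e′} ie he′ par e≢e′ with digon-of-parallel par e≢e′ | Digon.proper d
  ... | S₀ , d₀ | (s , Rs) , (t , Rt) with avoiding S₀ t
  ... | S , St , same with sides S (trans (same e) (Digon.cutf d₀)) | inside-elim H R {e} ie
  ... | record { x = x ; y = y ; Rx = Sx ; Ry = Sy ; to = to } | he , Rl , Rr =
      I , proj₁ found , proj₁ (proj₂ found) , proj₂ (proj₂ found) , cI , smaller
    where
    I U : Fin F → Bool
    I a = R a ∧ S a
    U a = R a ∨ S a
    Rxy : R x ≡ true × R y ≡ true
    Rxy = to R Rl Rr
    Ix : I x ≡ true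
    Ix = cong₂ _∧_ (proj₁ Rxy) Sx
    properI : Proper I
    properI = (x , Ix) , (t , cong (_∧ S t) Rt)
    properU : Proper U
    properU = (s , ∨-trueˡ (S s) Rs) , (t , cong₂ _∨_ Rt St)
    two : count (cut I) ≡ 2
    two = ≤-antisym (+-cancelʳ-≤ 2 (count (cut I)) 2 (≤-trans (+-monoʳ-≤ (count (cut I)) (cuts≥2 U properU))
            (≤-trans (submodular R S) (≤-reflexive (cong₂ _+_ (Digon.cuts d) (trans (count-cong same) (Digon.cuts d₀)))))))
          (cuts≥2 I properI)
    found : ∃ λ f′ → ∃ λ g′ → Digon I f′ g′
    found = digon-of-count I two
    cI : cut I ⊆ H
    cI a ca with cut R a in ra
    ... | true = cR a ra
    ... | false with Digon.only d₀ a (trans (sym (same a)) (cutS a ra ca))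
      where
      cutS : ∀ a → cut R a ≡ false → cut I a ≡ true → cut S a ≡ true
      cutS a ra ca with R (l a) | R (r a)
      ... | true | true = ca
      ... | false | false = ⊥-elim (true≢false (sym ca))
    ... | inj₁ q rewrite q = he
    ... | inj₂ q rewrite q = he′
    -- The face of `e` outside `S` lies in `R` and is lost.
    smaller : count I < count R
    smaller = subst (suc (count I) ≤_) (sym (count-∖ R (proj₂ Rxy)))
      (s≤s (count-mono (λ a p → ∖-intro R (proj₁ (∧-true (R a) p)) (λ q → true≢false (trans (sym (proj₂ (∧-true (R a) p))) (trans (cong S q) Sy))))))

  withEdge : (Fin E → Bool) → (Fin F → Bool) → Fin E → Fin E → Bool
  withEdge H R f e = inside H R e ∨ (e == f)

  -- The piece is glued on `f`, so `simple` includes `f`; the other boundary edge `g` is parallel to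
  -- it and has to stay out.
  record Innermost (H : Fin E → Bool) : Set where
    field
      R      : Fin F → Bool
      f g    : Fin E
      digon  : Digon R f g
      cut⊆   : cut R ⊆ H
      simple : Simple (withEdge H R f)

  -- Descent on the number of faces. A parallel pair among the inner edges and `f` contains an inner
  -- edge, so `uncross` applies to it.
  innermost : ∀ k {H R f g} → count R < k → Digon R f g → cut R ⊆ H → Innermost H
  innermost (suc k) {H} {R} {f} {g} bound d cR
    with any? (λ e → any? (λ e′ → (inside H R e Bool.≟ true) ×-dec (withEdge H R f e′ Bool.≟ true) ×-dec Par? e e′ ×-dec ¬? (e ≟ e′)))
  ... | yes (e , e′ , ie , ke′ , par , e≢e′) = recurse (uncross d cR ie he′ par e≢e′)
    where
    he′ : H e′ ≡ true
    he′ with ∨-true (inside H R e′) ke′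
    ... | inj₁ p = proj₁ (inside-elim H R {e′} p)
    ... | inj₂ p rewrite ==⇒≡ e′ f p = cR f (Digon.cutf d)
    recurse : (∃ λ R′ → ∃ λ f′ → ∃ λ g′ → Digon R′ f′ g′ × cut R′ ⊆ H × count R′ < count R) → Innermost H
    recurse (R′ , f′ , g′ , d′ , c′ , lt) = innermost k (≤-trans lt (≤-pred bound)) d′ c′
  ... | no none = record { R = R ; f = f ; g = g ; digon = d ; cut⊆ = cR ; simple = simple }
    where
    simple : Simple (withEdge H R f)
    simple {e} {e′} ke ke′ par with e ≟ e′
    ... | yes q = q
    ... | no q with ∨-true (inside H R e) ke | ∨-true (inside H R e′) ke′
    ... | inj₁ p | _ = ⊥-elim (none (e , e′ , p , ke′ , par , q))
    ... | inj₂ p | inj₁ p′ = ⊥-elim (none (e′ , e , p′ , ke , Par-sym par , q ∘ sym))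
    ... | inj₂ p | inj₂ p′ = trans (==⇒≡ e f p) (sym (==⇒≡ e′ f p′))

  -- The form of the hypothesis on 2-faces that passes to subgraphs arising by collapses. As either
  -- side of a 2-cycle is a digon, it demands an edge on both sides.
  No2Face : (Fin E → Bool) → Set
  No2Face H = ∀ R f g → Digon R f g → cut R ⊆ H → ∃ λ h → inside H R h ≡ true

  collapse : (Fin E → Bool) → (Fin F → Bool) → Fin E → Fin E → Bool
  collapse H R g e = H e ∧ (not (inside H R e) ∧ not (e == g))

  collapse-elim : ∀ H R g {e} → collapse H R g e ≡ true → H e ≡ true × inside H R e ≡ false × e ≢ g
  collapse-elim H R g {e} p with ∧-true (H e) p
  ... | h , q with ∧-true (not (inside H R e)) q
  ... | a , b = h , not-true a , λ t → contradiction (trans (sym (not-true b)) (trans (cong (_== g) t) (==-refl g))) (λ ())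

  collapse-intro : ∀ H R g {e} → H e ≡ true → inside H R e ≢ true → e ≢ g → collapse H R g e ≡ true
  collapse-intro H R g h a b rewrite h | ¬-not a | ≢⇒== b = refl

  -- A digon `R₁` of the collapsed graph is disjoint from `R` or contains it, since no surviving
  -- edge runs inside `R`. In each case an edge of `H` inside `R₁`, or inside what `R₁` has beyond
  -- `R`, survives the collapse, unless `f` itself already lies inside `R₁`.
  collapse-No2Face : ∀ {H R f g} → Digon R f g → cut R ⊆ H → No2Face H → No2Face (collapse H R g)
  collapse-No2Face {H} {R} {f} {g} d cR no2 R₁ f₁ g₁ d₁ c₁ with sides R (Digon.cutf d) | sides R (Digon.cutg d)
  ... | sf | sg = main (findTrue (λ t → R t ∧ R₁ t)) (findTrue (λ t → R t ∧ not (R₁ t)))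
    where
    H′ : Fin E → Bool
    H′ = collapse H R g
    t : Fin F
    t = Sides.y sf
    Rt : R t ≡ false
    Rt = Sides.Ry sf
    -- Edges of `H` inside `R` are gone, so a set bounded by surviving edges can split `R` only
    -- along `f` and `g`.
    straddle : ∀ S → (∀ e → cut S e ≡ true → cut R₁ e ≡ true) → ∀ e → cut (λ t → R t ∧ S t) e ≡ true → e ≡ f ⊎ e ≡ g
    straddle S S⊆ e ce with cut R e in re
    ... | true = Digon.only d e re
    ... | false with R (l e) in rl | R (r e) in rr
    ... | true | true = ⊥-elim (true≢false (trans (sym (inside-intro H R (proj₁ h) rl rr)) (proj₁ (proj₂ h))))
      where
      h : H e ≡ true × inside H R e ≡ false × e ≢ g
      h = collapse-elim H R g (c₁ e (S⊆ e ce))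
    ... | false | false = ⊥-elim (true≢false (sym ce))
    not-cut : ∀ e → cut (not ∘ R₁) e ≡ true → cut R₁ e ≡ true
    not-cut e p = trans (sym (xor-annihilates-not (R₁ (l e)) (R₁ (r e)))) p
    Goal : Set
    Goal = ∃ λ h → inside H′ R₁ h ≡ true
    -- A nonempty part of `R` cut out in this way has `f` in its boundary, hence contains the face
    -- of `f` inside `R`.
    meet-cut : ∀ S → (∀ e → cut S e ≡ true → cut R₁ e ≡ true) → ∀ {s} → R s ∧ S s ≡ true → S (Sides.x sf) ≡ true
    meet-cut S S⊆ {s} p = proj₂ (∧-true (R (Sides.x sf)) (xor-false-true
        (trans (sym (Sides.cut-xy sf (λ t → R t ∧ S t))) (proj₁ (both-cut (λ t → R t ∧ S t) ((s , p) , (t , cong (_∧ S t) Rt)) (straddle S S⊆))))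
        (cong (_∧ S t) Rt)))
      where
      xor-false-true : ∀ {a b} → a xor b ≡ true → b ≡ false → a ≡ true
      xor-false-true {true} p q = refl
      xor-false-true {false} p q = trans (sym q) p
    contained : (∀ s → R s ∧ not (R₁ s) ≡ false) → ∀ {s} → R s ≡ true → R₁ s ≡ true
    contained sub {s} a with R₁ s | sub s
    ... | true | _ = refl
    ... | false | q = trans (sym q) (trans (∧-identityʳ (R s)) a)
    main : ((∃ λ s → R s ∧ R₁ s ≡ true) ⊎ (∀ s → R s ∧ R₁ s ≡ false)) →
           ((∃ λ s → R s ∧ not (R₁ s) ≡ true) ⊎ (∀ s → R s ∧ not (R₁ s) ≡ false)) → Goal
    -- Disjoint case: `g` has a side in `R`, so the edge found inside `R₁` is neither `g` nor an
    -- inner edge of `R`.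
    main (inj₂ disjoint) _ = h , inside-intro H′ R₁ (collapse-intro H R g hH ¬in h≢g) hl hr
      where
      found : ∃ λ h → inside H R₁ h ≡ true
      found = no2 R₁ f₁ g₁ d₁ (λ e p → proj₁ (collapse-elim H R g (c₁ e p)))
      h : Fin E
      h = proj₁ found
      parts : H h ≡ true × R₁ (l h) ≡ true × R₁ (r h) ≡ true
      parts = inside-elim H R₁ {h} (proj₂ found)
      hH : H h ≡ true
      hH = proj₁ parts
      hl : R₁ (l h) ≡ true
      hl = proj₁ (proj₂ parts)
      hr : R₁ (r h) ≡ true
      hr = proj₂ (proj₂ parts)
      clash : ∀ {s} → R s ≡ true → R₁ s ≡ true → ⊥
      clash {s} a b = true≢false (trans (sym (cong₂ _∧_ a b)) (disjoint s))
      ¬in : inside H R h ≢ true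
      ¬in p = clash (proj₁ (proj₂ (inside-elim H R {h} p))) hl
      h≢g : h ≢ g
      h≢g q = clash (Sides.Rx sg) (proj₁ (Sides.to sg R₁ (trans (cong (R₁ ∘ l) (sym q)) hl) (trans (cong (R₁ ∘ r) (sym q)) hr)))
    -- The inner face at `f` would lie both in `R₁` and in its complement.
    main (inj₁ (s , p)) (inj₁ (s′ , p′)) = ⊥-elim (true≢false (trans (sym (meet-cut R₁ (λ e q → q) p)) (not-true (meet-cut (not ∘ R₁) not-cut p′))))
    main (inj₁ _) (inj₂ sub) with cut R₁ f in cf
    ... | false = f , inside-intro H′ R₁ (collapse-intro H R g (cR f (Digon.cutf d)) ¬in (Digon.f≢g d)) (proj₁ lr) (proj₂ lr)
      where
      R₁x : R₁ (Sides.x sf) ≡ true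
      R₁x = contained sub (Sides.Rx sf)
      R₁y : R₁ (Sides.y sf) ≡ true
      R₁y = trans (sym (xor-false (trans (sym (Sides.cut-xy sf R₁)) cf))) R₁x
      lr : R₁ (l f) ≡ true × R₁ (r f) ≡ true
      lr = Sides.from sf R₁ R₁x R₁y
      ¬in : inside H R f ≢ true
      ¬in p = true≢false (trans (sym (Digon.cutf d)) (inside-uncut H R p))
    ... | true = h , inside-intro H′ R₁ (collapse-intro H R g (proj₁ parts) ¬in h≢g) (proj₁ hlr) (proj₂ hlr)
      where
      -- If `f` is on the boundary of `R₁`, removing `R` replaces it by `g`. The result is a digon
      -- of `H`, and an edge inside it is not `g` and not inside `R`.
      R₂ : Fin F → Bool
      R₂ t = R₁ t ∧ not (R t)
      partner : ∃ λ k → k ≢ f × cut R₁ k ≡ true × (∀ e → cut R₁ e ≡ true → e ≡ f ⊎ e ≡ k)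
      partner with Digon.only d₁ f cf
      ... | inj₁ refl = g₁ , (Digon.f≢g d₁ ∘ sym) , Digon.cutg d₁ , Digon.only d₁
      ... | inj₂ refl = f₁ , Digon.f≢g d₁ , Digon.cutf d₁ , (λ e c → Sum.swap (Digon.only d₁ e c))
      k : Fin E
      k = proj₁ partner
      k≢f : k ≢ f
      k≢f = proj₁ (proj₂ partner)
      ck : cut R₁ k ≡ true
      ck = proj₁ (proj₂ (proj₂ partner))
      kparts : H k ≡ true × inside H R k ≡ false × k ≢ g
      kparts = collapse-elim H R g (c₁ k ck)
      g-uncut : cut R₁ g ≡ false
      g-uncut = ¬-not (λ p → proj₂ (proj₂ (collapse-elim H R g (c₁ g p))) refl)
      R₁gx : R₁ (Sides.x sg) ≡ true
      R₁gx = contained sub (Sides.Rx sg)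
      R₁gy : R₁ (Sides.y sg) ≡ true
      R₁gy = trans (sym (xor-false (trans (sym (Sides.cut-xy sg R₁)) g-uncut))) R₁gx
      cut₂g : cut R₂ g ≡ true
      cut₂g = trans (Sides.cut-xy sg R₂) (cong₂ _xor_ (cong₂ _∧_ R₁gx (cong not (Sides.Rx sg))) (cong₂ _∧_ R₁gy (cong not (Sides.Ry sg))))
      outside : ∀ {e} → cut R e ≡ false → inside H R e ≡ false → H e ≡ true → cut R₂ e ≡ cut R₁ e
      outside {e} a b c with R (l e) | R (r e)
      ... | true | true rewrite c = contradiction b (λ ())
      ... | false | false = cong₂ _xor_ (∧-identityʳ (R₁ (l e))) (∧-identityʳ (R₁ (r e)))
      k-uncut : cut R k ≡ false
      k-uncut = ¬-not (λ p → [ k≢f , proj₂ (proj₂ kparts) ]′ (Digon.only d k p))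
      cut₂k : cut R₂ k ≡ true
      cut₂k = trans (outside k-uncut (proj₁ (proj₂ kparts)) (proj₁ kparts)) ck
      uncut₂f : cut R₂ f ≡ false
      uncut₂f = trans (Sides.cut-xy sf R₂) (cong₂ _xor_ (trans (cong (λ b → R₁ (Sides.x sf) ∧ not b) (Sides.Rx sf)) (∧-zeroʳ _))
                        (cong (_∧ not (R (Sides.y sf))) R₁fy))
        where
        R₁fy : R₁ (Sides.y sf) ≡ false
        R₁fy with R₁ (Sides.y sf) in q
        ... | false = refl
        ... | true = contradiction (trans (sym cf) (trans (Sides.cut-xy sf R₁) (cong₂ _xor_ (contained sub (Sides.Rx sf)) q))) (λ ())
      only₂ : ∀ e → cut R₂ e ≡ true → e ≡ g ⊎ e ≡ k
      only₂ e c with cut R e in re | cut R₁ e in r₁e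
      ... | true | _ with Digon.only d e re
      ...   | inj₁ refl = contradiction (trans (sym c) uncut₂f) true≢false
      ...   | inj₂ q = inj₁ q
      only₂ e c | false | true with proj₂ (proj₂ (proj₂ partner)) e r₁e
      ...   | inj₁ refl = contradiction (trans (sym c) uncut₂f) true≢false
      ...   | inj₂ q = inj₂ q
      only₂ e c | false | false = contradiction
        (cong₂ (λ a b → a ∧ not b) (uncut R₁ r₁e) (uncut R re)) (cut-≢ R₂ c)
      d₂ : Digon R₂ g k
      d₂ = record { f≢g = λ q → proj₂ (proj₂ kparts) (sym q) ; cutf = cut₂g ; cutg = cut₂k ; only = only₂ }
      found : ∃ λ h → inside H R₂ h ≡ true
      found = no2 R₂ g k d₂ (λ e c → [ (λ q → subst (λ e → H e ≡ true) (sym q) (cR g (Digon.cutg d))) ,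
                                       (λ q → subst (λ e → H e ≡ true) (sym q) (proj₁ kparts)) ]′ (only₂ e c))
      h : Fin E
      h = proj₁ found
      parts : H h ≡ true × R₂ (l h) ≡ true × R₂ (r h) ≡ true
      parts = inside-elim H R₂ {h} (proj₂ found)
      hlr : R₁ (l h) ≡ true × R₁ (r h) ≡ true
      hlr = proj₁ (∧-true (R₁ (l h)) (proj₁ (proj₂ parts))) , proj₁ (∧-true (R₁ (r h)) (proj₂ (proj₂ parts)))
      ¬in : inside H R h ≢ true
      ¬in p = true≢false (trans (sym (proj₁ (proj₂ (inside-elim H R {h} p)))) (not-true (proj₂ (∧-true (R₁ (l h)) (proj₁ (proj₂ parts))))))
      h≢g : h ≢ g
      h≢g q = true≢false (trans (sym (trans (cong (cut R₂) q) cut₂g)) (inside-uncut H R₂ (proj₂ found)))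

-- Forests

module Forests {n E F : ℕ} (M : PlaneMap n E F) where
  open PlaneMap M
  open DecMembership (_≟_ {n}) using (_∈?_)

  Joined : Fin E → Fin n → Fin n → Set
  Joined e y z = (u e ≡ y × v e ≡ z) ⊎ (v e ≡ y × u e ≡ z)

  joined-par : ∀ {e e′ y z} → Joined e y z → Joined e′ y z → Par e e′
  joined-par (inj₁ (p , q)) (inj₁ (p′ , q′)) = inj₁ (trans p (sym p′) , trans q (sym q′))
  joined-par (inj₁ (p , q)) (inj₂ (p′ , q′)) = inj₂ (trans p (sym p′) , trans q (sym q′))
  joined-par (inj₂ (p , q)) (inj₁ (p′ , q′)) = inj₂ (trans q (sym q′) , trans p (sym p′))
  joined-par (inj₂ (p , q)) (inj₂ (p′ , q′)) = inj₁ (trans q (sym q′) , trans p (sym p′))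

  -- A forest as a list built from its tail: each new vertex has at most one edge to the older ones.
  -- Uniqueness concerns the edge, not the neighbour, so parallel edges are excluded too.
  data Forest (H : Fin E → Bool) : List (Fin n) → Set where
    []   : Forest H []
    cons : ∀ {z L} → z ∉ L →
      (∀ {e e′ y y′} → H e ≡ true → H e′ ≡ true → Joined e z y → Joined e′ z y′ → y ∈ L → y′ ∈ L → e ≡ e′) →
      Forest H L → Forest H (z ∷ L)

  forest-mono : ∀ {H H′ L} → (∀ {e} → H e ≡ true → u e ∈ L → v e ∈ L → H′ e ≡ true) → Forest H′ L → Forest H L
  forest-mono h [] = []
  forest-mono {H} {H′} {z ∷ L} h (cons z∉ un fo) = cons z∉
      (λ he he′ j j′ y∈ y′∈ → un (keep he j y∈) (keep he′ j′ y′∈) j j′ y∈ y′∈)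
      (forest-mono (λ he a b → h he (there a) (there b)) fo)
    where
    keep : ∀ {e y} → H e ≡ true → Joined e z y → y ∈ L → H′ e ≡ true
    keep he (inj₁ (refl , refl)) y∈ = h he (here refl) (there y∈)
    keep he (inj₂ (refl , refl)) y∈ = h he (there y∈) (here refl)

  -- The three lists may overlap; `total` counts a vertex once for each list that contains it.
  Classes : Set
  Classes = Fin 3 → List (Fin n)

  total : Classes → ℕ
  total S = sum (λ i → length (S i))

  mem : Fin n → List (Fin n) → Bool
  mem y L = does (y ∈? L)

  mem-sound : ∀ y L → mem y L ≡ true → y ∈ L
  mem-sound y L p with y ∈? L
  ... | yes q = q

  mem-complete : ∀ {y L} → y ∈ L → mem y L ≡ true
  mem-complete {y} {L} = dec-true (y ∈? L)

  put : Classes → Fin 3 → Fin n → Classes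
  put S i z j with j ≟ i
  ... | yes _ = z ∷ S j
  ... | no _ = S j

  put-∈ : ∀ S i z j {y} → y ∈ put S i z j → (y ≡ z × j ≡ i) ⊎ y ∈ S j
  put-∈ S i z j p with j ≟ i
  put-∈ S i z j (here q) | yes r = inj₁ (q , r)
  put-∈ S i z j (there q) | yes r = inj₂ q
  put-∈ S i z j p | no _ = inj₂ p

  put-total : ∀ S i z → total (put S i z) ≡ suc (total S)
  put-total S i z = trans (sum-cong-≗ pointwise) (trans (∑-distrib-+ (λ j → ⟦ j == i ⟧) (λ j → length (S j)))
      (cong (_+ total S) (count-single i)))
    where
    pointwise : ∀ j → length (put S i z j) ≡ ⟦ j == i ⟧ + length (S j)
    pointwise j with j ≟ i
    ... | yes _ = refl
    ... | no _ = refl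

  put-forest : ∀ {H S} i z → (∀ j → Forest H (S j)) → Forest H (z ∷ S i) → ∀ j → Forest H (put S i z j)
  put-forest i z fo fi j with j ≟ i
  ... | yes refl = fi
  ... | no _ = fo j

  -- Required of the ends of marked edges. That each end lies in at most one forest is what gives a
  -- port weight one and leaves a third class without ports.
  record Apart (S : Classes) (y z : Fin n) : Set where
    field
      disjoint : ∀ {i j} → y ∈ S i → z ∈ S j → i ≢ j
      unique₁  : ∀ {i j} → y ∈ S i → y ∈ S j → i ≡ j
      unique₂  : ∀ {i j} → z ∈ S i → z ∈ S j → i ≡ j

  apart-⊆ : ∀ {S S′ y z} → (∀ {i} → y ∈ S′ i → y ∈ S i) → (∀ {i} → z ∈ S′ i → z ∈ S i) → Apart S y z → Apart S′ y z
  apart-⊆ f g a = record { disjoint = λ p q → Apart.disjoint a (f p) (g q)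
                         ; unique₁ = λ p q → Apart.unique₁ a (f p) (f q) ; unique₂ = λ p q → Apart.unique₂ a (g p) (g q) }

  apart-swap : ∀ {S y z} → Apart S y z → Apart S z y
  apart-swap a = record { disjoint = λ p q r → Apart.disjoint a q p (sym r) ; unique₁ = Apart.unique₂ a ; unique₂ = Apart.unique₁ a }

-- Weighted degrees

-- For the set W of vertices still to be ordered: inner vertices are those in W, the special vertex is x, the ports are
-- the ends of the edge on which the piece is glued.
data Kind : Set where
  inner special port far : Kind

isInner isLow isHigh : Kind → Bool
isInner inner = true
isInner _ = false
isLow inner = true
isLow special = true
isLow _ = false
isHigh far = false
isHigh _ = true

-- An upper bound for the number of forests that can contain a vertex of this kind at the end of an
-- edge of the piece.
weight : Kind → ℕ
weight inner = 1
weight special = 2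
weight port = 1
weight far = 0

-- Summed over all edges, the right-hand side is bounded by Euler's formula for the vertex sets W ∪ {x} ∪ ports and W ∪ {x}.
weight-bound : ∀ a b → ⟦ isInner a ⟧ * weight b + ⟦ isInner b ⟧ * weight a ≤ ⟦ isHigh a ∧ isHigh b ⟧ + ⟦ isLow a ∧ isLow b ⟧
weight-bound inner inner = ≤-refl
weight-bound inner special = ≤-refl
weight-bound inner port = ≤-refl
weight-bound inner far = z≤n
weight-bound special inner = ≤-refl
weight-bound special special = z≤n
weight-bound special port = z≤n
weight-bound special far = z≤n
weight-bound port inner = ≤-refl
weight-bound port special = z≤n
weight-bound port port = z≤n
weight-bound port far = z≤n
weight-bound far inner = z≤n
weight-bound far special = z≤n
weight-bound far port = z≤n
weight-bound far far = z≤n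

sum-pick : ∀ {n} (a : Fin n) (g : Fin n → ℕ) → sum (λ v → ⟦ a == v ⟧ * g v) ≡ g a
sum-pick {suc n} zero g = trans (cong₂ _+_ (+-identityʳ (g zero)) (sum-zero {n} (λ _ → refl))) (+-identityʳ (g zero))
sum-pick (suc a) g = sum-pick a (g ∘ suc)

module Light {n E F : ℕ} (M : PlaneMap n E F) (In : Fin E → Bool) (f : Fin E) (x : Fin n)
  (simple : PlaneMap.Simple M (λ e → In e ∨ (e == f)))
  (f∉In : In f ≡ false)
  (x≢b : x ≢ PlaneMap.u M f) (x≢c : x ≢ PlaneMap.v M f) where
  open PlaneMap M
  open Forests M using (Joined; joined-par)

  b c : Fin n
  b = u f
  c = v f

  kind : (Fin n → Bool) → Fin n → Kind
  kind W y = if W y then inner else (if y == x then special else (if (y == b) ∨ (y == c) then port else far))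

  wt : (Fin n → Bool) → Fin n → ℕ
  wt W y = weight (kind W y)

  load : (Fin n → Bool) → Fin n → Fin E → ℕ
  load W z e = ⟦ In e ⟧ * (⟦ u e == z ⟧ * wt W (v e) + ⟦ v e == z ⟧ * wt W (u e))

  wdeg : (Fin n → Bool) → Fin n → ℕ
  wdeg W z = sum (load W z)

  isInner-kind : ∀ W y → isInner (kind W y) ≡ W y
  isInner-kind W y with W y
  ... | true = refl
  ... | false with y == x
  ... | true = refl
  ... | false with (y == b) ∨ (y == c)
  ... | true = refl
  ... | false = refl

  Apt : (Fin n → Bool) → Set
  Apt W = ∀ y → W y ≡ true → y ≢ x × y ≢ b × y ≢ c

  wdeg-total : ∀ W → sum (λ z → ⟦ W z ⟧ * wdeg W z) ≡
    sum (λ e → ⟦ In e ⟧ * (⟦ W (u e) ⟧ * wt W (v e) + ⟦ W (v e) ⟧ * wt W (u e)))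
  wdeg-total W = begin
    sum (λ z → ⟦ W z ⟧ * wdeg W z)               ≡⟨ sum-cong-≗ (λ z → sym (sum-*ˡ ⟦ W z ⟧ (load W z))) ⟩
    sum (λ z → sum (λ e → ⟦ W z ⟧ * load W z e)) ≡⟨ ∑-comm (λ z e → ⟦ W z ⟧ * load W z e) ⟩
    sum (λ e → sum (λ z → ⟦ W z ⟧ * load W z e)) ≡⟨ sum-cong-≗ per-edge ⟩
    _                                           ∎
    where
    open ≡-Reasoning
    rearrange : ∀ w i a p b q → w * (i * (a * p + b * q)) ≡ a * (i * (w * p)) + b * (i * (w * q))
    rearrange = solve-∀
    per-edge : ∀ e → sum (λ z → ⟦ W z ⟧ * load W z e) ≡ ⟦ In e ⟧ * (⟦ W (u e) ⟧ * wt W (v e) + ⟦ W (v e) ⟧ * wt W (u e))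
    per-edge e = begin
      sum (λ z → ⟦ W z ⟧ * load W z e)
        ≡⟨ sum-cong-≗ (λ z → rearrange ⟦ W z ⟧ ⟦ In e ⟧ ⟦ u e == z ⟧ (wt W (v e)) ⟦ v e == z ⟧ (wt W (u e))) ⟩
      sum (λ z → ⟦ u e == z ⟧ * p z + ⟦ v e == z ⟧ * q z)
        ≡⟨ ∑-distrib-+ (λ z → ⟦ u e == z ⟧ * p z) (λ z → ⟦ v e == z ⟧ * q z) ⟩
      sum (λ z → ⟦ u e == z ⟧ * p z) + sum (λ z → ⟦ v e == z ⟧ * q z)
        ≡⟨ cong₂ _+_ (sum-pick (u e) p) (sum-pick (v e) q) ⟩
      p (u e) + q (v e)
        ≡⟨ sym (*-distribˡ-+ ⟦ In e ⟧ (⟦ W (u e) ⟧ * wt W (v e)) (⟦ W (v e) ⟧ * wt W (u e))) ⟩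
      _ ∎
      where
      p q : Fin n → ℕ
      p z = ⟦ In e ⟧ * (⟦ W z ⟧ * wt W (v e))
      q z = ⟦ In e ⟧ * (⟦ W z ⟧ * wt W (u e))

  K : Fin E → Bool
  K e = In e ∨ (e == f)

  spanned : (Fin n → Bool) → Fin E → Bool
  spanned Y e = K e ∧ (Y (u e) ∧ Y (v e))

  spanned-bound : ∀ Y → 3 ≤ count Y → count (spanned Y) + 6 ≤ 3 * count Y
  spanned-bound Y = simple-bound (spanned Y) Y
    (λ {e} {e′} p q → simple (proj₁ (∧-true (K e) p)) (proj₁ (∧-true (K e′) q)))
    (λ e p → ∧-true (Y (u e)) (proj₂ (∧-true (K e) p)))

  low high : (Fin n → Bool) → Fin n → Bool
  low W y = isLow (kind W y)
  high W y = isHigh (kind W y)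

  count-low : ∀ W → Apt W → count (low W) ≡ count W + 1
  count-low W apt = trans (sum-cong-≗ pointwise) (trans (∑-distrib-+ (λ y → ⟦ W y ⟧) (λ y → ⟦ y == x ⟧)) (cong (count W +_) (count-single x)))
    where
    pointwise : ∀ y → ⟦ low W y ⟧ ≡ ⟦ W y ⟧ + ⟦ y == x ⟧
    pointwise y with W y in w
    ... | true rewrite ≢⇒== (proj₁ (apt y w)) = refl
    ... | false with y == x
    ... | true = refl
    ... | false with (y == b) ∨ (y == c)
    ... | true = refl
    ... | false = refl

  count-high : ∀ W → Apt W → count (high W) ≡ count W + 3
  count-high W apt = begin
    count (high W)                                  ≡⟨ sum-cong-≗ pointwise ⟩
    sum (λ y → ⟦ W y ⟧ + (⟦ y == x ⟧ + (⟦ y == b ⟧ + ⟦ y == c ⟧)))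
      ≡⟨ ∑-distrib-+ (λ y → ⟦ W y ⟧) (λ y → ⟦ y == x ⟧ + (⟦ y == b ⟧ + ⟦ y == c ⟧)) ⟩
    count W + sum (λ y → ⟦ y == x ⟧ + (⟦ y == b ⟧ + ⟦ y == c ⟧))
      ≡⟨ cong (count W +_) (∑-distrib-+ (λ y → ⟦ y == x ⟧) (λ y → ⟦ y == b ⟧ + ⟦ y == c ⟧)) ⟩
    count W + (count (_== x) + sum (λ y → ⟦ y == b ⟧ + ⟦ y == c ⟧))
      ≡⟨ cong₂ (λ s t → count W + (s + t)) (count-single x)
           (trans (∑-distrib-+ (λ y → ⟦ y == b ⟧) (λ y → ⟦ y == c ⟧)) (cong₂ _+_ (count-single b) (count-single c))) ⟩
    count W + 3                                     ∎
    where
    open ≡-Reasoning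
    pointwise : ∀ y → ⟦ high W y ⟧ ≡ ⟦ W y ⟧ + (⟦ y == x ⟧ + (⟦ y == b ⟧ + ⟦ y == c ⟧))
    pointwise y with W y in w
    ... | true rewrite ≢⇒== (proj₁ (apt y w)) | ≢⇒== (proj₁ (proj₂ (apt y w))) | ≢⇒== (proj₂ (proj₂ (apt y w))) = refl
    ... | false with y ≟ x
    ... | yes refl rewrite ≢⇒== x≢b | ≢⇒== x≢c = refl
    ... | no _ with y ≟ b | y ≟ c
    ... | yes p | yes q = contradiction (trans (sym p) q) (u≢v f)
    ... | yes p | no q = refl
    ... | no p | yes q = refl
    ... | no p | no q = refl

  port-high : ∀ W {y} → (y == b) ∨ (y == c) ≡ true → high W y ≡ true
  port-high W {y} p with W y
  ... | true = refl
  ... | false with y == x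
  ... | true = refl
  ... | false rewrite p = refl

  -- The edge `f` joins the two ports: it carries no load but is spanned by `high W`. This is the
  -- spare unit.
  edge-load : ∀ W e → ⟦ In e ⟧ * (⟦ W (u e) ⟧ * wt W (v e) + ⟦ W (v e) ⟧ * wt W (u e)) + ⟦ e == f ⟧
                      ≤ ⟦ spanned (high W) e ⟧ + ⟦ spanned (low W) e ⟧
  edge-load W e with e ≟ f
  ... | yes refl rewrite f∉In | port-high W {b} (∨-trueˡ (b == c) (==-refl b)) | port-high W {c} (∨-trueʳ (c == b) (==-refl c)) = s≤s z≤n
  ... | no _ with In e
  ... | false = z≤n
  ... | true = ≤-trans (≤-reflexive (trans (trans (+-identityʳ _) (*-identityˡ _))
                 (sym (cong₂ (λ s t → ⟦ s ⟧ * wt W (v e) + ⟦ t ⟧ * wt W (u e)) (isInner-kind W (u e)) (isInner-kind W (v e))))))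
                 (weight-bound (kind W (u e)) (kind W (v e)))

  -- Two vertices in `W` are required because `low W`, with `x`, must reach the three vertices of
  -- the bound for simple graphs.
  total-load : ∀ W → Apt W → 2 ≤ count W → sum (λ z → ⟦ W z ⟧ * wdeg W z) < 6 * count W
  total-load W apt w≥2 = arith {w = count W} (≤-trans (≤-reflexive (sym split)) (≤-trans (sum-mono (edge-load W))
      (≤-reflexive (∑-distrib-+ (λ e → ⟦ spanned (high W) e ⟧) (λ e → ⟦ spanned (low W) e ⟧)))))
      (subst (λ t → count (spanned (high W)) + 6 ≤ 3 * t) (count-high W apt)
        (spanned-bound (high W) (subst (3 ≤_) (sym (count-high W apt)) (m≤n+m 3 (count W)))))
      (subst (λ t → count (spanned (low W)) + 6 ≤ 3 * t) (count-low W apt)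
        (spanned-bound (low W) (subst (3 ≤_) (sym (count-low W apt)) (+-monoˡ-≤ 1 w≥2))))
    where
    L : ℕ
    L = sum (λ z → ⟦ W z ⟧ * wdeg W z)
    split : sum (λ e → ⟦ In e ⟧ * (⟦ W (u e) ⟧ * wt W (v e) + ⟦ W (v e) ⟧ * wt W (u e)) + ⟦ e == f ⟧) ≡ L + 1
    split = trans (∑-distrib-+ (λ e → ⟦ In e ⟧ * (⟦ W (u e) ⟧ * wt W (v e) + ⟦ W (v e) ⟧ * wt W (u e))) (λ e → ⟦ e == f ⟧))
      (cong₂ _+_ (sym (wdeg-total W)) (count-single f))
    arith : ∀ {L h l w} → L + 1 ≤ h + l → h + 6 ≤ 3 * (w + 3) → l + 6 ≤ 3 * (w + 1) → suc L ≤ 6 * w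
    arith {L} {h} {l} {w} p q r = linear (h + l + 12) (+-mono-≤ p (+-mono-≤ q r)) (≤-reflexive (lhs L h l)) (≤-reflexive (rhs h l w))
      where
      lhs : ∀ L h l → h + l + 12 + suc L ≡ L + 1 + (h + 6 + (l + 6))
      lhs = solve-∀
      rhs : ∀ h l w → h + l + (3 * (w + 3) + 3 * (w + 1)) ≡ h + l + 12 + 6 * w
      rhs = solve-∀

  between : Fin n → Fin n → Fin E → Bool
  between z y e = In e ∧ (((u e == z) ∧ (v e == y)) ∨ ((v e == z) ∧ (u e == y)))

  between-ends : ∀ z y {e} → between z y e ≡ true → In e ≡ true × Joined e z y
  between-ends z y {e} p with ∧-true (In e) p
  ... | i , q with ∨-true ((u e == z) ∧ (v e == y)) q
  ... | inj₁ s = i , inj₁ (==⇒≡ (u e) z (proj₁ (∧-true (u e == z) s)) , ==⇒≡ (v e) y (proj₂ (∧-true (u e == z) s)))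
  ... | inj₂ s = i , inj₂ (==⇒≡ (v e) z (proj₁ (∧-true (v e == z) s)) , ==⇒≡ (u e) y (proj₂ (∧-true (v e == z) s)))

  between-unique : ∀ z y → count (between z y) ≤ 1
  between-unique z y = unique⇒count≤1 (between z y) (λ {e} {e′} p q →
    simple (∨-trueˡ (e == f) (proj₁ (between-ends z y {e} p))) (∨-trueˡ (e′ == f) (proj₁ (between-ends z y {e′} q)))
      (joined-par (proj₂ (between-ends z y {e} p)) (proj₂ (between-ends z y {e′} q))))

  -- By simplicity there is at most one edge to each port and one to `x`, of weight two: four in
  -- all.
  wdeg-alone : ∀ W z → W z ≡ true → count (W ∖ z) ≡ 0 → wdeg W z ≤ 5
  wdeg-alone W z wz alone = ≤-trans (sum-mono per-edge) (≤-trans (≤-reflexive distrib)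
      (≤-trans (+-mono-≤ (between-unique z b) (+-mono-≤ (between-unique z c) (+-mono-≤ (between-unique z x) (between-unique z x)))) (n≤1+n 4)))
    where
    B : Fin n → Fin E → ℕ
    B y e = ⟦ between z y e ⟧
    distrib : sum (λ e → B b e + (B c e + (B x e + B x e))) ≡
      count (between z b) + (count (between z c) + (count (between z x) + count (between z x)))
    distrib = trans (∑-distrib-+ (B b) (λ e → B c e + (B x e + B x e)))
      (cong (sum (B b) +_) (trans (∑-distrib-+ (B c) (λ e → B x e + B x e)) (cong (sum (B c) +_) (∑-distrib-+ (B x) (B x)))))
    wt-alone : ∀ y → y ≢ z → wt W y ≤ ⟦ y == b ⟧ + (⟦ y == c ⟧ + (⟦ y == x ⟧ + ⟦ y == x ⟧))
    wt-alone y y≢z with W y in wy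
    ... | true = contradiction (trans (sym (∖-intro W wy y≢z)) (count≡0 (W ∖ z) alone y)) true≢false
    ... | false with y ≟ x
    ... | yes refl rewrite ≢⇒== x≢b | ≢⇒== x≢c = ≤-refl
    ... | no _ with y == b | y == c
    ... | true | _ = s≤s z≤n
    ... | false | true = s≤s z≤n
    ... | false | false = z≤n
    per-edge : ∀ e → load W z e ≤ B b e + (B c e + (B x e + B x e))
    per-edge e with In e
    ... | false = z≤n
    ... | true with u e ≟ z | v e ≟ z
    ... | yes p | yes q = contradiction (trans p (sym q)) (u≢v e)
    ... | yes p | no q = subst₂ _≤_ (sym (trans (+-identityʳ _) (trans (+-identityʳ _) (+-identityʳ _)))) (cong₂ _+_ (∨f (v e == b)) (cong₂ _+_ (∨f (v e == c)) (cong₂ _+_ (∨f (v e == x)) (∨f (v e == x))))) (wt-alone (v e) q)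
      where
      ∨f : ∀ a → ⟦ a ⟧ ≡ ⟦ a ∨ false ⟧
      ∨f true = refl
      ∨f false = refl
    ... | no p | yes q = subst (_≤ _) (sym (trans (+-identityʳ _) (+-identityʳ _))) (wt-alone (u e) p)
    ... | no p | no q = z≤n

  light : ∀ W → Apt W → ∀ {m} → count W ≡ suc m → ∃ λ z → W z ≡ true × wdeg W z ≤ 5
  light W apt {zero} cW with extract W cW
  ... | z , wz , rest = z , wz , wdeg-alone W z wz rest
  light W apt {suc m} cW = light-element W (wdeg W) 5 (total-load W apt (subst (2 ≤_) (sym cW) (s≤s (s≤s z≤n))))

-- Extending three forests to a piece

-- `In` are the edges of the piece, `A` its new vertices, `T` the forests found so far. The ends of
-- `f` may lie only in `i` and `j` respectively, so `k` is free of them. `two` records whether `x`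
-- enters a second forest.
module Greedy {n E F : ℕ} (M : PlaneMap n E F)
  (H In D : Fin E → Bool) (f : Fin E) (A : Fin n → Bool) (T : Forests.Classes M)
  (simple : PlaneMap.Simple M (λ e → In e ∨ (e == f)))
  (f∉In : In f ≡ false)
  (near : ∀ {e z} → In e ≡ true → PlaneMap.Inc M e z → A z ≡ true ⊎ PlaneMap.Inc M f z)
  (own : ∀ {e z} → H e ≡ true → PlaneMap.Inc M e z → A z ≡ true → In e ≡ true)
  (f∉A : ∀ {z} → PlaneMap.Inc M f z → A z ≡ false)
  (T-out : ∀ {y i} → y ∈ T i → A y ≡ false)
  (T-forest : ∀ i → Forests.Forest M H (T i))
  (i j k : Fin 3) (i≢j : i ≢ j) (k≢i : k ≢ i) (k≢j : k ≢ j)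
  (b-loc : ∀ {h} → PlaneMap.u M f ∈ T h → h ≡ i)
  (c-loc : ∀ {h} → PlaneMap.v M f ∈ T h → h ≡ j)
  (x : Fin n) (x∈A : A x ≡ true)
  (two : Bool) (unmarked : two ≡ true → ∀ e → In e ≡ true → D e ≡ false)
  where
  open PlaneMap M
  open Forests M

  outside : ∀ {y z} → A y ≡ true → A z ≡ false → y ≢ z
  outside p q refl = true≢false (trans (sym p) q)

  x≢b : x ≢ u f
  x≢b = outside x∈A (f∉A (inj₁ refl))

  x≢c : x ≢ v f
  x≢c = outside x∈A (f∉A (inj₂ refl))

  open Light M In f x simple f∉In x≢b x≢c

  DIn : Fin E → Bool
  DIn e = In e ∧ D e

  DIn-In : ∀ {e} → DIn e ≡ true → In e ≡ true
  DIn-In {e} p = proj₁ (∧-true (In e) p)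

  single : ∀ {e} → DIn e ≡ true → two ≢ true
  single {e} p t = true≢false (trans (sym (proj₂ (∧-true (In e) p))) (unmarked t e (DIn-In {e} p)))

  Inside : (Fin n → Bool) → Set
  Inside W = ∀ y → W y ≡ true → A y ≡ true × y ≢ x

  inside-apt : ∀ {W} → Inside W → Apt W
  inside-apt in-A y wy = proj₂ (in-A y wy) , outside (proj₁ (in-A y wy)) (f∉A (inj₁ refl)) , outside (proj₁ (in-A y wy)) (f∉A (inj₂ refl))

  -- The vertex `x` is left out on purpose: marked edges at `x` are thereby never charged.
  placed : (Fin n → Bool) → Fin n → Bool
  placed W y = W y ∨ ((y == b) ∨ (y == c))

  -- the marked edges that may already have caused a vertex to be dropped
  paid : (Fin n → Bool) → Fin E → Bool
  paid W e = DIn e ∧ (placed W (u e) ∧ placed W (v e))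

  -- In `size`, every vertex of `W` is either added to a forest or charged to a marked edge of its
  -- own; `1 + ⟦ two ⟧` stands for the copies of `x`.
  record State (W : Fin n → Bool) : Set where
    field
      S      : Classes
      sub    : ∀ {y h} → y ∈ S h → y ∈ T h ⊎ y ≡ x ⊎ W y ≡ true
      at-x   : ∀ {h} → x ∈ S h → h ≡ k ⊎ (two ≡ true × h ≡ i)
      one    : ∀ {y h h′} → W y ≡ true → y ∈ S h → y ∈ S h′ → h ≡ h′
      forest : ∀ h → Forest H (S h)
      marks  : ∀ {e} → DIn e ≡ true → Apart S (u e) (v e)
      size   : total T + count W + 1 + ⟦ two ⟧ ≤ total S + count (paid W)

  joined-inc₁ : ∀ {e y z} → Joined e y z → Inc e y
  joined-inc₁ (inj₁ (p , q)) = inj₁ p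
  joined-inc₁ (inj₂ (p , q)) = inj₂ p

  joined-inc₂ : ∀ {e y z} → Joined e y z → Inc e z
  joined-inc₂ (inj₁ (p , q)) = inj₂ q
  joined-inc₂ (inj₂ (p , q)) = inj₁ q

  x∉T : ∀ {h} → x ∉ T h
  x∉T p = true≢false (trans (sym x∈A) (T-out p))

  module Start where
    port-of : ∀ {e y h} → H e ≡ true → Joined e x y → y ∈ T h → (y ≡ b × h ≡ i) ⊎ (y ≡ c × h ≡ j)
    port-of {e} he jo y∈ with near (own he (joined-inc₁ jo) x∈A) (joined-inc₂ jo)
    ... | inj₁ ay = contradiction (trans (sym ay) (T-out y∈)) true≢false
    ... | inj₂ (inj₁ refl) = inj₁ (refl , b-loc y∈)
    ... | inj₂ (inj₂ refl) = inj₂ (refl , c-loc y∈)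

    -- Old vertices adjacent to `x` are ports, and none of them lies in class `k`.
    at-k : Forest H (x ∷ T k)
    at-k = cons x∉T (λ he _ jo _ y∈ _ → [ (λ p → ⊥-elim (k≢i (proj₂ p))) , (λ p → ⊥-elim (k≢j (proj₂ p))) ]′ (port-of he jo y∈)) (T-forest k)

    at-i : Forest H (x ∷ T i)
    at-i = cons x∉T unique (T-forest i)
      where
      is-b : ∀ {e y} → H e ≡ true → Joined e x y → y ∈ T i → y ≡ b
      is-b he jo y∈ = [ proj₁ , (λ p → ⊥-elim (i≢j (proj₂ p))) ]′ (port-of he jo y∈)
      unique : ∀ {e e′ y y′} → H e ≡ true → H e′ ≡ true → Joined e x y → Joined e′ x y′ → y ∈ T i → y′ ∈ T i → e ≡ e′
      unique {e} {e′} he he′ jo jo′ y∈ y′∈ with is-b he jo y∈ | is-b he′ jo′ y′∈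
      ... | refl | refl = simple (∨-trueˡ (e == f) (own he (joined-inc₁ jo) x∈A)) (∨-trueˡ (e′ == f) (own he′ (joined-inc₁ jo′) x∈A)) (joined-par jo jo′)

    -- Among the possible ends of an edge of the piece only `x`, `b` and `c` can be in a forest so
    -- far, and only in `k`, `i` and `j`.
    apart : two ≢ true → ∀ {e} → DIn e ≡ true → Apart (put T k x) (u e) (v e)
    apart t {e} de = record
      { disjoint = λ p q → different (locate (near (DIn-In {e} de) (inj₁ refl)) p) (locate (near (DIn-In {e} de) (inj₂ refl)) q)
      ; unique₁ = λ p q → same (locate (near (DIn-In {e} de) (inj₁ refl)) p) (locate (near (DIn-In {e} de) (inj₁ refl)) q)
      ; unique₂ = λ p q → same (locate (near (DIn-In {e} de) (inj₂ refl)) p) (locate (near (DIn-In {e} de) (inj₂ refl)) q) }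
      where
      Loc : Fin n → Fin 3 → Set
      Loc y h = (y ≡ x × h ≡ k) ⊎ (y ≡ b × h ≡ i) ⊎ (y ≡ c × h ≡ j)
      locate : ∀ {y h} → A y ≡ true ⊎ Inc f y → y ∈ put T k x h → Loc y h
      locate {h = h} ny y∈ with put-∈ T k x h y∈
      ... | inj₁ p = inj₁ p
      locate (inj₁ ay) y∈ | inj₂ q = contradiction (trans (sym ay) (T-out q)) true≢false
      locate (inj₂ (inj₁ refl)) y∈ | inj₂ q = inj₂ (inj₁ (refl , b-loc q))
      locate (inj₂ (inj₂ refl)) y∈ | inj₂ q = inj₂ (inj₂ (refl , c-loc q))
      different : ∀ {h h′} → Loc (u e) h → Loc (v e) h′ → h ≢ h′
      different (inj₁ (p , _)) (inj₁ (q , _)) = ⊥-elim (u≢v e (trans p (sym q)))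
      different (inj₁ (_ , refl)) (inj₂ (inj₁ (_ , refl))) = k≢i
      different (inj₁ (_ , refl)) (inj₂ (inj₂ (_ , refl))) = k≢j
      different (inj₂ (inj₁ (_ , refl))) (inj₁ (_ , refl)) = k≢i ∘ sym
      different (inj₂ (inj₁ (p , _))) (inj₂ (inj₁ (q , _))) = ⊥-elim (u≢v e (trans p (sym q)))
      different (inj₂ (inj₁ (_ , refl))) (inj₂ (inj₂ (_ , refl))) = i≢j
      different (inj₂ (inj₂ (_ , refl))) (inj₁ (_ , refl)) = k≢j ∘ sym
      different (inj₂ (inj₂ (_ , refl))) (inj₂ (inj₁ (_ , refl))) = i≢j ∘ sym
      different (inj₂ (inj₂ (p , _))) (inj₂ (inj₂ (q , _))) = ⊥-elim (u≢v e (trans p (sym q)))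
      same : ∀ {y h h′} → Loc y h → Loc y h′ → h ≡ h′
      same (inj₁ (_ , refl)) (inj₁ (_ , refl)) = refl
      same (inj₁ (p , _)) (inj₂ (inj₁ (q , _))) = ⊥-elim (x≢b (trans (sym p) q))
      same (inj₁ (p , _)) (inj₂ (inj₂ (q , _))) = ⊥-elim (x≢c (trans (sym p) q))
      same (inj₂ (inj₁ (p , _))) (inj₁ (q , _)) = ⊥-elim (x≢b (trans (sym q) p))
      same (inj₂ (inj₁ (_ , refl))) (inj₂ (inj₁ (_ , refl))) = refl
      same (inj₂ (inj₁ (p , _))) (inj₂ (inj₂ (q , _))) = ⊥-elim (u≢v f (trans (sym p) q))
      same (inj₂ (inj₂ (p , _))) (inj₁ (q , _)) = ⊥-elim (x≢c (trans (sym q) p))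
      same (inj₂ (inj₂ (p , _))) (inj₂ (inj₁ (q , _))) = ⊥-elim (u≢v f (trans (sym q) p))
      same (inj₂ (inj₂ (_ , refl))) (inj₂ (inj₂ (_ , refl))) = refl

    old-or-x : ∀ {W : Fin n → Bool} {S : List (Fin n)} {y} {h l : Fin 3} → (y ≡ x × h ≡ l) ⊎ y ∈ S → y ∈ S ⊎ y ≡ x ⊎ W y ≡ true
    old-or-x (inj₁ (p , _)) = inj₂ (inj₁ p)
    old-or-x (inj₂ q) = inj₁ q

    start : ∀ W → count W ≡ 0 → ∀ t → two ≡ t → State W
    start W cW false tw = record
      { S = put T k x
      ; sub = λ {y} {h} p → old-or-x {W} {T h} {y} {h} {k} (put-∈ T k x h p)
      ; at-x = λ {h} p → [ (λ q → inj₁ (proj₂ q)) , (λ q → ⊥-elim (x∉T q)) ]′ (put-∈ T k x h p)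
      ; one = λ {y} wy → contradiction (trans (sym wy) (count≡0 W cW y)) true≢false
      ; forest = put-forest k x T-forest at-k
      ; marks = apart (λ t → true≢false (trans (sym t) tw))
      ; size = ≤-trans (≤-reflexive (trans (cong₂ (λ t s → total T + t + 1 + ⟦ s ⟧) cW tw) (trans (arith (total T)) (sym (put-total T k x))))) (m≤m+n _ _) }
      where
      arith : ∀ t → t + 0 + 1 + 0 ≡ suc t
      arith = solve-∀
    start W cW true tw = record
      { S = put (put T k x) i x
      ; sub = λ {y} {h} p → [ (λ q → inj₂ (inj₁ (proj₁ q))) , (λ q → old-or-x {W} {T h} {y} {h} {k} (put-∈ T k x h q)) ]′ (put-∈ (put T k x) i x h p)
      ; at-x = λ {h} p → [ (λ q → inj₂ (tw , proj₂ q)) , (λ q → [ (λ r → inj₁ (proj₂ r)) , (λ r → ⊥-elim (x∉T r)) ]′ (put-∈ T k x h q)) ]′ (put-∈ (put T k x) i x h p)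
      ; one = λ {y} wy → contradiction (trans (sym wy) (count≡0 W cW y)) true≢false
      ; forest = put-forest i x (put-forest k x T-forest at-k) at-i′
      ; marks = λ {e} de → ⊥-elim (single {e} de tw)
      ; size = ≤-trans (≤-reflexive (trans (cong₂ (λ t s → total T + t + 1 + ⟦ s ⟧) cW tw) (trans (arith (total T)) (sym (trans (put-total (put T k x) i x) (cong suc (put-total T k x))))))) (m≤m+n _ _) }
      where
      arith : ∀ t → t + 0 + 1 + 1 ≡ suc (suc t)
      arith = solve-∀
      at-i′ : Forest H (x ∷ put T k x i)
      at-i′ with i ≟ k
      ... | yes p = ⊥-elim (k≢i (sym p))
      ... | no _ = at-i

  module Step (W : Fin n → Bool) (in-A : Inside W) (z : Fin n) (wz : W z ≡ true) (wz≤5 : wdeg W z ≤ 5) (st : State (W ∖ z)) where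
    open State st

    z∈A : A z ≡ true
    z∈A = proj₁ (in-A z wz)

    z≢x : z ≢ x
    z≢x = proj₂ (in-A z wz)

    z∉S : ∀ {h} → z ∉ S h
    z∉S z∈ with sub z∈
    ... | inj₁ p = true≢false (trans (sym z∈A) (T-out p))
    ... | inj₂ (inj₁ p) = z≢x p
    ... | inj₂ (inj₂ p) = true≢false (trans (sym p) (∖-self W z))

    sub-W : ∀ {y h} → y ∈ S h → y ∈ T h ⊎ y ≡ x ⊎ W y ≡ true
    sub-W y∈ with sub y∈
    ... | inj₁ p = inj₁ p
    ... | inj₂ (inj₁ p) = inj₂ (inj₁ p)
    ... | inj₂ (inj₂ p) = inj₂ (inj₂ (∖-⊆ W p))

    one-W : ∀ {y h h′} → W y ≡ true → y ∈ S h → y ∈ S h′ → h ≡ h′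
    one-W {y} wy p q with y ≟ z
    ... | yes refl = ⊥-elim (z∉S p)
    ... | no y≢z = one (∖-intro W wy y≢z) p q

    placed-mono : ∀ y → placed (W ∖ z) y ≡ true → placed W y ≡ true
    placed-mono y p with ∨-true ((W ∖ z) y) p
    ... | inj₁ q = ∨-trueˡ _ (∖-⊆ W q)
    ... | inj₂ q = ∨-trueʳ (W y) q

    paid-elim : ∀ W {e} → paid W e ≡ true → DIn e ≡ true × placed W (u e) ≡ true × placed W (v e) ≡ true
    paid-elim W {e} p = proj₁ (∧-true (DIn e) p) , ∧-true (placed W (u e)) (proj₂ (∧-true (DIn e) p))

    paid-intro : ∀ W {e} → DIn e ≡ true → placed W (u e) ≡ true → placed W (v e) ≡ true → paid W e ≡ true
    paid-intro W p q r = cong₂ _∧_ p (cong₂ _∧_ q r)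

    paid-mono : ∀ e → paid (W ∖ z) e ≡ true → paid W e ≡ true
    paid-mono e p with paid-elim (W ∖ z) {e} p
    ... | d , q , r = paid-intro W {e} d (placed-mono (u e) q) (placed-mono (v e) r)

    unplaced : placed (W ∖ z) z ≡ false
    unplaced rewrite ∖-self W z | ≢⇒== (outside z∈A (f∉A (inj₁ refl))) | ≢⇒== (outside z∈A (f∉A (inj₂ refl))) = refl

    inc : Fin E → Fin n → Bool
    inc e y = (u e == y) ∨ (v e == y)

    inc-sound : ∀ {e y} → inc e y ≡ true → Inc e y
    inc-sound {e} {y} p = Sum.map (==⇒≡ (u e) y) (==⇒≡ (v e) y) (∨-true (u e == y) p)

    inc-complete : ∀ {e y} → Inc e y → inc e y ≡ true
    inc-complete {e} (inj₁ refl) = ∨-trueˡ _ (==-refl (u e))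
    inc-complete {e} (inj₂ refl) = ∨-trueʳ (u e == v e) (==-refl (v e))

    -- The edge `e` could not be paid before, as its end `z` was not placed. So the number of paid
    -- edges grows and covers the loss of `z`.
    dropped : ∀ {e} → paid W e ≡ true → Inc e z → State W
    dropped {e} pe ie = record
      { S = S ; sub = sub-W ; at-x = at-x ; one = one-W ; forest = forest ; marks = marks
      ; size = arith {t = total T} {s = total S} {β = ⟦ two ⟧} (count-∖ W wz) size (subst (count (paid (W ∖ z)) <_) (sym (count-∖ (paid W) pe)) (s≤s (count-mono fewer))) }
      where
      not-before : paid (W ∖ z) e ≢ true
      not-before q = [ (λ r → clash r (proj₁ (proj₂ (paid-elim (W ∖ z) {e} q)))) , (λ r → clash r (proj₂ (proj₂ (paid-elim (W ∖ z) {e} q)))) ]′ ie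
        where
        clash : ∀ {y} → y ≡ z → placed (W ∖ z) y ≢ true
        clash refl p = true≢false (trans (sym p) unplaced)
      fewer : ∀ a → paid (W ∖ z) a ≡ true → (paid W ∖ e) a ≡ true
      fewer a p = ∖-intro (paid W) (paid-mono a p) (λ { refl → not-before p })
      arith : ∀ {t w w′ s p p′ β} → w ≡ suc w′ → t + w′ + 1 + β ≤ s + p′ → p′ < p → t + w + 1 + β ≤ s + p
      arith {t} {w} {w′} {s} {p} {p′} {β} refl a b = linear p′ (+-mono-≤ a b) (≤-reflexive (lhs t w′ p′ β)) (≤-reflexive (rhs s p p′))
        where
        lhs : ∀ t w p β → p + (t + suc w + 1 + β) ≡ t + w + 1 + β + suc p
        lhs = solve-∀
        rhs : ∀ s p p′ → s + p′ + p ≡ p′ + (s + p)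
        rhs = solve-∀

    module Keep (unpaid : ∀ e → paid W e ≡ true → ¬ Inc e z) where

      touch : Fin 3 → Fin E → Bool
      touch h e = In e ∧ (((u e == z) ∧ mem (v e) (S h)) ∨ ((v e == z) ∧ mem (u e) (S h)))

      memberships : (Fin 3 → Bool) → Fin n → ℕ
      memberships ok y = sum (λ h → ⟦ ok h ⟧ * ⟦ mem y (S h) ⟧)

      memberships≤ : ∀ ok y → memberships ok y ≤ count (λ h → mem y (S h))
      memberships≤ ok y = sum-mono (λ h → shrink (ok h) ⟦ mem y (S h) ⟧)
        where
        shrink : ∀ a m → ⟦ a ⟧ * m ≤ m
        shrink true m = ≤-reflexive (*-identityˡ m)
        shrink false m = z≤n

      located : ∀ y g → (∀ {h} → y ∈ S h → h ≡ g) → count (λ h → mem y (S h)) ≤ 1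
      located y g loc = unique⇒count≤1 (λ h → mem y (S h))
        (λ {h} {h′} p q → trans (loc (mem-sound y (S h) p)) (sym (loc (mem-sound y (S h′) q))))

      -- Ports stay in the class of `T` where they are, ordered vertices enter at most one forest,
      -- `x` lies at most in `k` and `i`, and other vertices of `A` in none.
      weight-covers : ∀ ok y → y ≢ z → A y ≡ true ⊎ Inc f y → memberships ok y ≤ wt W y
      weight-covers ok y y≢z ny = ≤-trans (memberships≤ ok y) (bound ny)
        where
        T-loc : ∀ {h} → Inc f y → y ∈ S h → y ∈ T h
        T-loc i′ p with sub p
        ... | inj₁ q = q
        ... | inj₂ (inj₁ refl) = contradiction (trans (sym x∈A) (f∉A i′)) true≢false
        ... | inj₂ (inj₂ q) = contradiction (trans (sym (proj₁ (in-A y (∖-⊆ W q)))) (f∉A i′)) true≢false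
        port-wt : (y == b) ∨ (y == c) ≡ true → A y ≡ false → 1 ≤ wt W y
        port-wt p ay with W y in wy
        ... | true = s≤s z≤n
        ... | false with y ≟ x
        ... | yes q = s≤s z≤n
        ... | no _ rewrite p = s≤s z≤n
        bound : A y ≡ true ⊎ Inc f y → count (λ h → mem y (S h)) ≤ wt W y
        bound (inj₂ i′@(inj₁ refl)) = ≤-trans (located y i (λ p → b-loc (T-loc i′ p))) (port-wt (∨-trueˡ (b == c) (==-refl b)) (f∉A i′))
        bound (inj₂ i′@(inj₂ refl)) = ≤-trans (located y j (λ p → c-loc (T-loc i′ p))) (port-wt (∨-trueʳ (c == b) (==-refl c)) (f∉A i′))
        bound (inj₁ ay) with W y in wy
        ... | true = unique⇒count≤1 (λ h → mem y (S h)) (λ {h} {h′} p q → one-W wy (mem-sound y (S h) p) (mem-sound y (S h′) q))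
        ... | false with y ≟ x
        ... | yes refl = ≤-trans (sum-mono k-or-i) (≤-reflexive (trans (∑-distrib-+ (λ h → ⟦ h == k ⟧) (λ h → ⟦ h == i ⟧)) (cong₂ _+_ (count-single k) (count-single i))))
          where
          k-or-i : ∀ h → ⟦ mem x (S h) ⟧ ≤ ⟦ h == k ⟧ + ⟦ h == i ⟧
          k-or-i h with mem x (S h) in m
          ... | false = z≤n
          ... | true with at-x (mem-sound x (S h) m)
          ... | inj₁ refl rewrite ==-refl h = s≤s z≤n
          ... | inj₂ (_ , refl) rewrite ==-refl h = m≤n+m 1 _
        ... | no y≢x = ≤-trans (≤-reflexive (count-false (λ h → mem y (S h)) (λ h → ¬-not (λ m → nowhere (mem-sound y (S h) m))))) z≤n
          where
          nowhere : ∀ {h} → y ∉ S h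
          nowhere p with sub p
          ... | inj₁ q = true≢false (trans (sym ay) (T-out q))
          ... | inj₂ (inj₁ q) = y≢x q
          ... | inj₂ (inj₂ q) = true≢false (trans (sym (∖-⊆ W q)) wy)

      touches : (Fin 3 → Bool) → Fin E → ℕ
      touches ok e = sum (λ h → ⟦ ok h ⟧ * ⟦ touch h e ⟧)

      touches-joined : ∀ ok {e y} → In e ≡ true → Joined e z y → touches ok e ≡ memberships ok y × load W z e ≡ wt W y
      touches-joined ok {e} {y} ie (inj₁ (refl , refl)) rewrite ie | ==-refl (u e) | ≢⇒== (u≢v e ∘ sym) =
        sum-cong-≗ (λ h → cong (λ t → ⟦ ok h ⟧ * ⟦ t ⟧) (∨-identityʳ (mem y (S h)))) ,
        trans (+-identityʳ _) (trans (+-identityʳ _) (+-identityʳ _))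
      touches-joined ok {e} {y} ie (inj₂ (refl , refl)) rewrite ie | ==-refl (v e) | ≢⇒== (u≢v e) =
        refl , trans (+-identityʳ _) (+-identityʳ _)

      per-edge : ∀ ok e → touches ok e ≤ load W z e
      per-edge ok e with In e in ie | u e ≟ z | v e ≟ z
      ... | false | _ | _ = ≤-reflexive (sum-zero (λ h → *-zeroʳ ⟦ ok h ⟧))
      ... | true | no _ | no _ = ≤-reflexive (sum-zero (λ h → *-zeroʳ ⟦ ok h ⟧))
      ... | true | yes p | yes q = ⊥-elim (u≢v e (trans p (sym q)))
      ... | true | yes refl | no q = subst₂ _≤_ (sym (sum-cong-≗ (λ h → cong (λ t → ⟦ ok h ⟧ * ⟦ t ⟧) (∨-identityʳ (mem (v e) (S h))))))
             (sym (trans (+-identityʳ _) (trans (+-identityʳ _) (+-identityʳ _))))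
             (weight-covers ok (v e) q (near ie (inj₂ refl)))
      ... | true | no p | yes refl = subst (_ ≤_) (sym (trans (+-identityʳ _) (+-identityʳ _))) (weight-covers ok (u e) p (near ie (inj₁ refl)))

      choose : ∀ ok → sum (touches ok) < 2 * count ok → ∃ λ h → ok h ≡ true × count (touch h) ≤ 1
      choose ok lt = light-element ok (λ h → count (touch h)) 1 (subst (_< 2 * count ok) swap lt)
        where
        swap : sum (touches ok) ≡ sum (λ h → ⟦ ok h ⟧ * count (touch h))
        swap = trans (∑-comm (λ e h → ⟦ ok h ⟧ * ⟦ touch h e ⟧)) (sum-cong-≗ (λ h → sum-*ˡ ⟦ ok h ⟧ (λ e → ⟦ touch h e ⟧)))

      -- If `z` is joined to `x` by a marked edge, then `x` lies at most in `k`, so avoiding `k`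
      -- keeps the two ends apart.
      Choice : Set
      Choice = ∃ λ h → count (touch h) ≤ 1 × (∀ {e} → DIn e ≡ true → Inc e z → Inc e x → h ≢ k)

      choice : Choice
      choice with findTrue (λ e → DIn e ∧ (inc e z ∧ inc e x))
      -- All three forests are allowed, and 5 < 2 * 3.
      ... | inj₂ none with choose (λ _ → true) (s≤s (≤-trans (sum-mono (per-edge (λ _ → true))) wz≤5))
      ...   | h , _ , c≤1 = h , c≤1 , λ {e} de iz ix → contradiction
                (trans (sym (cong₂ _∧_ de (cong₂ _∧_ (inc-complete {e} iz) (inc-complete {e} ix)))) (none e)) true≢false
      -- Class `k` is forbidden. The edge `e₀` to `x` has weight two but touches neither of the
      -- other classes, so these receive at most 5 - 2 edges, and 3 < 2 * 2.
      choice | inj₁ (e₀ , p) with choose ok (subst (sum (touches ok) <_) (cong (2 *_) (sym count-ok)) (linear 2 tight ≤-refl (≤-reflexive refl)))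
        where
        ok : Fin 3 → Bool
        ok h = not (h == k)
        count-ok : count ok ≡ 2
        count-ok = suc-injective (sym (count-∖ (λ _ → true) {k} refl))
        parts : DIn e₀ ≡ true × inc e₀ z ≡ true × inc e₀ x ≡ true
        parts = proj₁ (∧-true (DIn e₀) p) , ∧-true (inc e₀ z) (proj₂ (∧-true (DIn e₀) p))
        jo : Joined e₀ z x
        jo with inc-sound {e₀} (proj₁ (proj₂ parts)) | inc-sound {e₀} (proj₂ (proj₂ parts))
        ... | inj₁ a | inj₁ b = ⊥-elim (z≢x (trans (sym a) b))
        ... | inj₁ a | inj₂ b = inj₁ (a , b)
        ... | inj₂ a | inj₁ b = inj₂ (a , b)
        ... | inj₂ a | inj₂ b = ⊥-elim (z≢x (trans (sym a) b))
        only-k : ∀ h → ⟦ ok h ⟧ * ⟦ mem x (S h) ⟧ ≡ 0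
        only-k h with mem x (S h) in m
        ... | false = *-zeroʳ ⟦ ok h ⟧
        ... | true with at-x (mem-sound x (S h) m)
        ... | inj₁ refl rewrite ==-refl h = refl
        ... | inj₂ (t , _) = ⊥-elim (single {e₀} (proj₁ parts) t)
        at-e₀ : touches ok e₀ ≡ 0 × load W z e₀ ≡ 2
        at-e₀ with touches-joined ok {e₀} (DIn-In {e₀} (proj₁ parts)) jo
        ... | a , b = trans a (sum-zero only-k) , trans b wt-x
          where
          wt-x : wt W x ≡ 2
          wt-x with W x in wx
          ... | true = ⊥-elim (proj₂ (in-A x wx) refl)
          ... | false rewrite ==-refl x = refl
        saving : ∀ e → touches ok e + 2 * ⟦ e == e₀ ⟧ ≤ load W z e
        saving e with e ≟ e₀
        ... | yes refl = ≤-reflexive (trans (cong (_+ 2) (proj₁ at-e₀)) (sym (proj₂ at-e₀)))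
        ... | no _ = ≤-trans (≤-reflexive (+-identityʳ _)) (per-edge ok e)
        tight : 2 + suc (sum (touches ok)) ≤ 6
        tight = s≤s (≤-trans (≤-reflexive (trans (+-comm 2 (sum (touches ok)))
          (sym (trans (∑-distrib-+ (touches ok) (λ e → 2 * ⟦ e == e₀ ⟧))
            (cong (sum (touches ok) +_) (trans (sum-*ˡ 2 (λ e → ⟦ e == e₀ ⟧)) (cong (2 *_) (count-single e₀))))))))
          (≤-trans (sum-mono saving) wz≤5))
      ... | h , okh , c≤1 = h , c≤1 , λ _ _ _ q → contradiction (trans (sym (not-true okh)) (trans (cong (_== k) q) (==-refl k))) (λ ())

      kept : Choice → State W
      kept (h , c≤1 , tied) = record
        { S = put S h z
        ; sub = λ {y} {g} p → [ (λ q → inj₂ (inj₂ (trans (cong W (proj₁ q)) wz))) , sub-W ]′ (put-∈ S h z g p)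
        ; at-x = λ {g} p → [ (λ q → ⊥-elim (z≢x (sym (proj₁ q)))) , at-x ]′ (put-∈ S h z g p)
        ; one = one′
        ; forest = put-forest h z forest (cons z∉S unique (forest h))
        ; marks = λ {e} de → marks′ {e} de
        ; size = ≤-trans (≤-reflexive (trans (cong (λ t → total T + t + 1 + ⟦ two ⟧) (count-∖ W wz)) (arith (total T) (count (W ∖ z)) ⟦ two ⟧)))
            (≤-trans (s≤s size) (+-mono-≤ (≤-reflexive (sym (put-total S h z))) (count-mono paid-mono))) }
        where
        arith : ∀ t w β → t + suc w + 1 + β ≡ suc (t + w + 1 + β)
        arith = solve-∀
        z-only : ∀ {g} → z ∈ put S h z g → g ≡ h
        z-only {g} p = [ proj₂ , (λ q → ⊥-elim (z∉S q)) ]′ (put-∈ S h z g p)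
        old : ∀ {y g} → y ≢ z → y ∈ put S h z g → y ∈ S g
        old {g = g} y≢z p = [ (λ q → ⊥-elim (y≢z (proj₁ q))) , id ]′ (put-∈ S h z g p)
        one′ : ∀ {y g g′} → W y ≡ true → y ∈ put S h z g → y ∈ put S h z g′ → g ≡ g′
        one′ {y} wy p q with y ≟ z
        ... | yes refl = trans (z-only p) (sym (z-only q))
        ... | no y≢z = one-W wy (old y≢z p) (old y≢z q)
        touched : ∀ {e y} → H e ≡ true → Joined e z y → y ∈ S h → touch h e ≡ true
        touched {e} {y} he (inj₁ (refl , refl)) y∈ = cong₂ _∧_ (own he (inj₁ refl) z∈A)
          (∨-trueˡ _ (cong₂ _∧_ (==-refl (u e)) (mem-complete {L = S h} y∈)))
        touched {e} {y} he (inj₂ (refl , refl)) y∈ = cong₂ _∧_ (own he (inj₂ refl) z∈A)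
          (∨-trueʳ ((u e == v e) ∧ mem (v e) (S h)) (cong₂ _∧_ (==-refl (v e)) (mem-complete {L = S h} y∈)))
        unique : ∀ {e e′ y y′} → H e ≡ true → H e′ ≡ true → Joined e z y → Joined e′ z y′ → y ∈ S h → y′ ∈ S h → e ≡ e′
        unique he he′ jo jo′ y∈ y′∈ = count≤1⇒unique (touch h) c≤1 (touched he jo y∈) (touched he′ jo′ y′∈)
        pay : ∀ {e y} → DIn e ≡ true → Joined e z y → placed W y ≡ true → paid W e ≡ true
        pay {e} de (inj₁ (refl , refl)) py = paid-intro W {e} de (∨-trueˡ _ wz) py
        pay {e} de (inj₂ (refl , refl)) py = paid-intro W {e} de py (∨-trueˡ _ wz)
        -- Any other vertex in a forest is placed and would make the marked edge paid, which
        -- `unpaid` excludes.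
        is-x : ∀ {e y g} → DIn e ≡ true → Joined e z y → y ∈ S g → y ≡ x
        is-x {e} {y} de jo y∈ with sub y∈
        ... | inj₂ (inj₁ q) = q
        ... | inj₂ (inj₂ q) = ⊥-elim (unpaid e (pay {e} de jo (∨-trueˡ _ (∖-⊆ W q))) (joined-inc₁ jo))
        ... | inj₁ q with near (DIn-In {e} de) (joined-inc₂ jo)
        ... | inj₁ ay = contradiction (trans (sym ay) (T-out q)) true≢false
        ... | inj₂ (inj₁ refl) = ⊥-elim (unpaid e (pay {e} de jo (∨-trueʳ (W b) (∨-trueˡ _ (==-refl b)))) (joined-inc₁ jo))
        ... | inj₂ (inj₂ refl) = ⊥-elim (unpaid e (pay {e} de jo (∨-trueʳ (W c) (∨-trueʳ (c == b) (==-refl c)))) (joined-inc₁ jo))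
        x-at-k : ∀ {e g} → DIn e ≡ true → x ∈ S g → g ≡ k
        x-at-k {e} de x∈ = [ id , (λ q → ⊥-elim (single {e} de (proj₁ q))) ]′ (at-x x∈)
        apart-z : ∀ {e y} → DIn e ≡ true → Joined e z y → y ≢ z → Apart (put S h z) z y
        apart-z {e} {y} de jo y≢z = record
          { disjoint = λ {_} {g} p q r → tied {e} de (joined-inc₁ jo) (subst (Inc e) (is-x {e} de jo (old {g = g} y≢z q)) (joined-inc₂ jo))
              (trans (sym (z-only p)) (trans r (at-k q)))
          ; unique₁ = λ p q → trans (z-only p) (sym (z-only q))
          ; unique₂ = λ p q → trans (at-k p) (sym (at-k q)) }
          where
          at-k : ∀ {g} → y ∈ put S h z g → g ≡ k
          at-k {g} q = x-at-k {e} de (subst (_∈ S g) (is-x {e} de jo (old {g = g} y≢z q)) (old {g = g} y≢z q))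
        marks′ : ∀ {e} → DIn e ≡ true → Apart (put S h z) (u e) (v e)
        marks′ {e} de with u e ≟ z | v e ≟ z
        ... | yes p | yes q = ⊥-elim (u≢v e (trans p (sym q)))
        ... | yes refl | no q = apart-z {e} de (inj₁ (refl , refl)) q
        ... | no p | yes refl = apart-swap (apart-z {e} de (inj₂ (refl , refl)) p)
        ... | no p | no q = apart-⊆ (λ {g} → old {g = g} p) (λ {g} → old {g = g} q) (marks {e} de)

    step : State W
    step with findTrue (λ e → paid W e ∧ inc e z)
    ... | inj₁ (e , p) = dropped {e} (proj₁ (∧-true (paid W e) p)) (inc-sound {e} (proj₂ (∧-true (paid W e) p)))
    ... | inj₂ none = Keep.kept unpaid (Keep.choice unpaid)
      where
      unpaid : ∀ e → paid W e ≡ true → ¬ Inc e z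
      unpaid e pe ie = true≢false (trans (sym (cong₂ _∧_ pe (inc-complete {e} ie))) (none e))

  -- The order is found backwards: the light vertex of `W` comes last, so its weighted degree in `W`
  -- counts exactly the edges to vertices handled before it.
  state : ∀ m W → count W ≡ m → Inside W → State W
  state zero W cW in-A = Start.start W cW two refl
  state (suc m) W cW in-A with light W (inside-apt in-A) cW
  ... | z , wz , wz≤5 = Step.step W in-A z wz wz≤5
        (state m (W ∖ z) (suc-injective (trans (sym (count-∖ W wz)) cW)) (λ y p → in-A y (∖-⊆ W p)))

-- Reassembling the pieces

third : (i j : Fin 3) → ∃ λ k → k ≢ i × k ≢ j
third zero zero = suc zero , (λ ()) , (λ ())
third zero (suc zero) = suc (suc zero) , (λ ()) , (λ ())
third zero (suc (suc zero)) = suc zero , (λ ()) , (λ ())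
third (suc zero) zero = suc (suc zero) , (λ ()) , (λ ())
third (suc zero) (suc zero) = zero , (λ ()) , (λ ())
third (suc zero) (suc (suc zero)) = zero , (λ ()) , (λ ())
third (suc (suc zero)) zero = suc zero , (λ ()) , (λ ())
third (suc (suc zero)) (suc zero) = zero , (λ ()) , (λ ())
third (suc (suc zero)) (suc (suc zero)) = zero , (λ ()) , (λ ())

module Assembly {n E F : ℕ} (M : PlaneMap n E F) where
  open PlaneMap M
  open Digons M
  open Forests M
  open DecMembership (_≟_ {n}) using (_∈?_)

  -- A port in no forest gets an arbitrary class different from that of the other.
  ports : ∀ {S b c} → Apart S b c → ∃ λ i → ∃ λ j → i ≢ j × (∀ {h} → b ∈ S h → h ≡ i) × (∀ {h} → c ∈ S h → h ≡ j)
  ports {S} {b} {c} ap with any? (λ h → b ∈? S h) | any? (λ h → c ∈? S h)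
  ... | yes (i , p) | yes (j , q) = i , j , Apart.disjoint ap p q , (λ r → Apart.unique₁ ap r p) , (λ r → Apart.unique₂ ap r q)
  ... | yes (i , p) | no q with third i i
  ...   | j , j≢i , _ = i , j , j≢i ∘ sym , (λ r → Apart.unique₁ ap r p) , (λ r → ⊥-elim (q (_ , r)))
  ports {S} {b} {c} ap | no p | yes (j , q) with third j j
  ...   | i , i≢j , _ = i , j , i≢j , (λ r → ⊥-elim (p (_ , r))) , (λ r → Apart.unique₂ ap r q)
  ports {S} {b} {c} ap | no p | no q = zero , suc zero , (λ ()) , (λ r → ⊥-elim (p (_ , r))) , (λ r → ⊥-elim (q (_ , r)))

  -- The `+ 1` in `size` pays for the mark on `f`, which may vanish when the piece is put back.
  record Extension (H In D : Fin E → Bool) (A : Fin n → Bool) (T : Classes) : Set where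
    field
      S      : Classes
      sub    : ∀ {y h} → y ∈ S h → y ∈ T h ⊎ A y ≡ true
      forest : ∀ h → Forest H (S h)
      marks  : ∀ {e} → In e ≡ true → D e ≡ true → Apart S (u e) (v e)
      size   : total T + count A + 1 ≤ total S + count (λ e → In e ∧ D e)

  module _
    (H In D : Fin E → Bool) (f : Fin E) (A : Fin n → Bool) (T : Classes)
    (simple : Simple (λ e → In e ∨ (e == f)))
    (f∉In : In f ≡ false)
    (near : ∀ {e z} → In e ≡ true → Inc e z → A z ≡ true ⊎ Inc f z)
    (own : ∀ {e z} → H e ≡ true → Inc e z → A z ≡ true → In e ≡ true)
    (f∉A : ∀ {z} → Inc f z → A z ≡ false)
    (T-out : ∀ {y i} → y ∈ T i → A y ≡ false)
    (T-forest : ∀ i → Forest H (T i))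
    where

    -- An edge with both ends on `f` would be parallel to `f`.
    has-A : ∀ {e} → In e ≡ true → ∃ λ z → Inc e z × A z ≡ true
    has-A {e} ie with near ie (inj₁ refl) | near ie (inj₂ refl)
    ... | inj₁ a | _ = u e , inj₁ refl , a
    ... | inj₂ _ | inj₁ a = v e , inj₂ refl , a
    ... | inj₂ p | inj₂ q = contradiction (trans (sym ie) (trans (cong In e≡f) f∉In)) true≢false
      where
      e≡f : e ≡ f
      e≡f = simple (∨-trueˡ (e == f) ie) (∨-trueʳ (In f) (==-refl f)) (par-of-ends p q)

    extend : ∀ i j → i ≢ j → (∀ {h} → u f ∈ T h → h ≡ i) → (∀ {h} → v f ∈ T h → h ≡ j) →
      (∃ λ x → A x ≡ true) → Extension H In D A T
    extend i j i≢j b-loc c-loc (x₀ , ax₀) with findTrue (λ e → In e ∧ D e) | third i j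
    -- Without marked edges any vertex serves as `x`, and its second copy is the extra unit.
    ... | inj₂ none | k , k≢i , k≢j = record
        { S = G.State.S st ; sub = sub ; forest = G.State.forest st ; marks = λ ie de → G.State.marks st (cong₂ _∧_ ie de)
        ; size = ≤-trans (≤-reflexive (trans (cong (λ t → total T + t + 1) (count-∖ A ax₀)) (arith (total T) (count W))))
                 (≤-trans (G.State.size st) (+-monoʳ-≤ (total (G.State.S st)) (count-mono (λ e p → proj₁ (∧-true (In e ∧ D e) p))))) }
      where
      W : Fin n → Bool
      W = A ∖ x₀
      unmarked : true ≡ true → ∀ e → In e ≡ true → D e ≡ false
      unmarked _ e ie = ¬-not (λ de → true≢false (trans (sym (cong₂ _∧_ ie de)) (none e)))
      module G = Greedy M H In D f A T simple f∉In near own f∉A T-out T-forest i j k i≢j k≢i k≢j b-loc c-loc x₀ ax₀ true unmarked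
      st : G.State W
      st = G.state (count W) W refl (λ y p → ∖-⊆ A p , ∖-≢ A p)
      sub : ∀ {y h} → y ∈ G.State.S st h → y ∈ T h ⊎ A y ≡ true
      sub p with G.State.sub st p
      ... | inj₁ q = inj₁ q
      ... | inj₂ (inj₁ refl) = inj₂ ax₀
      ... | inj₂ (inj₂ q) = inj₂ (∖-⊆ A q)
      arith : ∀ t w → t + suc w + 1 ≡ t + w + 1 + 1
      arith = solve-∀
    -- With `x` on the marked edge `e₀`, this edge is never paid; it is the extra unit.
    ... | inj₁ (e₀ , p₀) | k , k≢i , k≢j with has-A (proj₁ (∧-true (In e₀) p₀))
    ... | x , ix , ax = record
        { S = G.State.S st ; sub = sub ; forest = G.State.forest st ; marks = λ ie de → G.State.marks st (cong₂ _∧_ ie de)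
        ; size = arith {t = total T} {s = total (G.State.S st)} (count-∖ A ax) (G.State.size st)
                   (subst (count (G.paid W) <_) (sym (count-∖ (λ e → In e ∧ D e) p₀)) (s≤s (count-mono fewer))) }
      where
      W : Fin n → Bool
      W = A ∖ x
      module G = Greedy M H In D f A T simple f∉In near own f∉A T-out T-forest i j k i≢j k≢i k≢j b-loc c-loc x ax false (λ ())
      st : G.State W
      st = G.state (count W) W refl (λ y p → ∖-⊆ A p , ∖-≢ A p)
      sub : ∀ {y h} → y ∈ G.State.S st h → y ∈ T h ⊎ A y ≡ true
      sub p with G.State.sub st p
      ... | inj₁ q = inj₁ q
      ... | inj₂ (inj₁ refl) = inj₂ ax
      ... | inj₂ (inj₂ q) = inj₂ (∖-⊆ A q)
      x-unplaced : G.placed W x ≡ false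
      x-unplaced rewrite ∖-self A x | ≢⇒== G.x≢b | ≢⇒== G.x≢c = refl
      clash : ∀ {y} → y ≡ x → G.placed W y ≢ true
      clash refl q = true≢false (trans (sym q) x-unplaced)
      unpaid : G.paid W e₀ ≢ true
      unpaid q with ∧-true (G.placed W (u e₀)) (proj₂ (∧-true (In e₀ ∧ D e₀) q))
      ... | a , b = [ (λ r → clash r a) , (λ r → clash r b) ]′ ix
      fewer : ∀ e → G.paid W e ≡ true → ((λ e → In e ∧ D e) ∖ e₀) e ≡ true
      fewer e q = ∖-intro (λ e → In e ∧ D e) (proj₁ (∧-true (In e ∧ D e) q)) (λ { refl → unpaid q })
      arith : ∀ {t a w s p d} → a ≡ suc w → t + w + 1 + 0 ≤ s + p → p < d → t + a + 1 ≤ s + d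
      arith {t} {a} {w} {s} {p} {d} refl q r = linear p (+-mono-≤ q r) (≤-reflexive (lhs t w p)) (≤-reflexive (rhs s p d))
        where
        lhs : ∀ t w p → p + (t + suc w + 1) ≡ t + w + 1 + 0 + suc p
        lhs = solve-∀
        rhs : ∀ s p d → s + p + d ≡ p + (s + d)
        rhs = solve-∀

  -- The induction invariant. Each marked edge may cost one vertex; with no marks it is the bound
  -- wanted for the whole graph.
  record Good (H : Fin E → Bool) (U : Fin n → Bool) (D : Fin E → Bool) : Set where
    field
      S      : Classes
      sub    : ∀ {y h} → y ∈ S h → U y ≡ true
      forest : ∀ h → Forest H (S h)
      marks  : ∀ {e} → D e ≡ true → Apart S (u e) (v e)
      size   : count U + 1 ≤ total S + count D

  Inc? : ∀ e z → Dec (Inc e z)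
  Inc? e z = (u e ≟ z) ⊎-dec (v e ≟ z)

  singleton-forest : ∀ {H} z → Forest H (z ∷ [])
  singleton-forest z = cons (λ ()) (λ _ _ _ _ ()) []

  -- A simple graph is treated as a piece glued on one of its own edges, whose ends open the first
  -- two forests.
  module Base (H : Fin E → Bool) (U : Fin n → Bool) (D : Fin E → Bool)
    (ends : ∀ {e z} → H e ≡ true → Inc e z → U z ≡ true) (D⊆H : ∀ {e} → D e ≡ true → H e ≡ true)
    (simple : Simple H) (f : Fin E) (hf : H f ≡ true) where

    In : Fin E → Bool
    In = H ∖ f

    A : Fin n → Bool
    A = U ∖ u f ∖ v f

    T : Classes
    T zero = u f ∷ []
    T (suc zero) = v f ∷ []
    T (suc (suc zero)) = []

    A-elim : ∀ {z} → A z ≡ true → U z ≡ true × ¬ Inc f z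
    A-elim p = ∖-⊆ U (∖-⊆ (U ∖ u f) p) , [ (λ q → ∖-≢ U (∖-⊆ (U ∖ u f) p) (sym q)) , (λ q → ∖-≢ (U ∖ u f) p (sym q)) ]′

    A-intro : ∀ {z} → U z ≡ true → ¬ Inc f z → A z ≡ true
    A-intro uz ni = ∖-intro (U ∖ u f) (∖-intro U uz (λ q → ni (inj₁ (sym q)))) (λ q → ni (inj₂ (sym q)))

    count-U : count U ≡ suc (suc (count A))
    count-U = trans (count-∖ U (ends hf (inj₁ refl)))
      (cong suc (count-∖ (U ∖ u f) (∖-intro U (ends hf (inj₂ refl)) (u≢v f ∘ sym))))

    T-port : ∀ {y h} → y ∈ T h → Inc f y
    T-port {h = zero} (here refl) = inj₁ refl
    T-port {h = suc zero} (here refl) = inj₂ refl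
    T-port {h = suc (suc zero)} ()

    b-loc : ∀ {h} → u f ∈ T h → h ≡ zero
    b-loc {zero} p = refl
    b-loc {suc zero} (here q) = ⊥-elim (u≢v f q)
    b-loc {suc (suc zero)} ()

    c-loc : ∀ {h} → v f ∈ T h → h ≡ suc zero
    c-loc {zero} (here q) = ⊥-elim (u≢v f (sym q))
    c-loc {suc zero} p = refl
    c-loc {suc (suc zero)} ()

    T-forest : ∀ h → Forest H (T h)
    T-forest zero = singleton-forest (u f)
    T-forest (suc zero) = singleton-forest (v f)
    T-forest (suc (suc zero)) = []

    apart-T : Apart T (u f) (v f)
    apart-T = record { disjoint = λ p q r → contradiction (trans (sym (b-loc p)) (trans r (c-loc q))) (λ ())
                     ; unique₁ = λ p q → trans (b-loc p) (sym (b-loc q)) ; unique₂ = λ p q → trans (c-loc p) (sym (c-loc q)) }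

    In∪f : ∀ {e} → In e ∨ (e == f) ≡ true → H e ≡ true
    In∪f {e} p with ∨-true (In e) p
    ... | inj₁ q = ∖-⊆ H q
    ... | inj₂ q rewrite ==⇒≡ e f q = hf

    large : (∃ λ x → A x ≡ true) → Good H U D
    large some = record
      { S = X.S
      ; sub = λ p → [ (λ q → ends hf (T-port q)) , (λ q → proj₁ (A-elim q)) ]′ (X.sub p)
      ; forest = X.forest
      ; marks = marks
      ; size = ≤-trans (≤-reflexive (trans (cong (_+ 1) count-U) refl))
               (≤-trans X.size (+-monoʳ-≤ (total X.S) (count-mono (λ e p → proj₂ (∧-true (In e) p))))) }
      where
      ext : Extension H In D A T
      ext = extend H In D f A T (λ {e} {e′} p q → simple (In∪f {e} p) (In∪f {e′} q)) (∖-self H f) near own f∉A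
              (λ p → f∉A (T-port p)) T-forest zero (suc zero) (λ ()) b-loc c-loc some
        where
        near : ∀ {e z} → In e ≡ true → Inc e z → A z ≡ true ⊎ Inc f z
        near {e} {z} ie iz with Inc? f z
        ... | yes p = inj₂ p
        ... | no p = inj₁ (A-intro (ends (∖-⊆ H ie) iz) p)
        own : ∀ {e z} → H e ≡ true → Inc e z → A z ≡ true → In e ≡ true
        own he iz az = ∖-intro H he (λ { refl → proj₂ (A-elim az) iz })
        f∉A : ∀ {z} → Inc f z → A z ≡ false
        f∉A iz = ¬-not (λ az → proj₂ (A-elim az) iz)
      module X = Extension ext
      old : ∀ {y h} → Inc f y → y ∈ X.S h → y ∈ T h
      old iy p = [ id , (λ q → ⊥-elim (proj₂ (A-elim q) iy)) ]′ (X.sub p)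
      marks : ∀ {e} → D e ≡ true → Apart X.S (u e) (v e)
      marks {e} de with e ≟ f
      ... | yes refl = apart-⊆ (old (inj₁ refl)) (old (inj₂ refl)) apart-T
      ... | no q = X.marks (∖-intro H (D⊆H de) q) de

    module _ (none : ∀ z → A z ≡ false) where

      only-f : ∀ {e} → D e ≡ true → e ≡ f
      only-f {e} de = simple (D⊆H de) hf (par-of-ends (at-f (inj₁ refl)) (at-f (inj₂ refl)))
        where
        at-f : ∀ {z} → Inc e z → Inc f z
        at-f {z} iz with Inc? f z
        ... | yes p = p
        ... | no p = contradiction (trans (sym (A-intro (ends (D⊆H de) iz) p)) (none z)) true≢false

      three : count U + 1 ≡ 3
      three = cong (_+ 1) (trans count-U (cong (λ t → suc (suc t)) (count-false A none)))

      -- Only the ends of `f` exist, and three units are needed: two vertices and the mark on `f`,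
      -- or else one vertex in all three forests.
      small : Good H U D
      small with findTrue D
      ... | inj₁ (e , de) = record
        { S = T ; sub = λ p → ends hf (T-port p) ; forest = T-forest
        ; marks = λ {e} de → subst (λ e → Apart T (u e) (v e)) (sym (only-f de)) apart-T
        ; size = ≤-trans (≤-reflexive three) (+-monoʳ-≤ 2 (count≥1 D de)) }
      ... | inj₂ unmarked = record
        { S = λ _ → u f ∷ [] ; sub = λ { (here refl) → ends hf (inj₁ refl) } ; forest = λ _ → singleton-forest (u f)
        ; marks = λ {e} de → contradiction (trans (sym de) (unmarked e)) true≢false
        ; size = ≤-trans (≤-reflexive three) (m≤m+n 3 _) }

    good : Good H U D
    good with findTrue A
    ... | inj₁ some = large some
    ... | inj₂ none = small none

  module Collapse (H : Fin E → Bool) (U : Fin n → Bool) (D : Fin E → Bool)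
    (ends : ∀ {e z} → H e ≡ true → Inc e z → U z ≡ true) (D⊆H : ∀ {e} → D e ≡ true → H e ≡ true)
    (no2 : No2Face H) (inn : Innermost H) where
    open Innermost inn

    In H′ D′ : Fin E → Bool
    In = inside H R
    H′ = collapse H R g
    -- The mark on `f` keeps its ends in different forests, so that restoring `g` closes no cycle
    -- and the ports of the piece have distinct classes.
    D′ e = (D e ∧ H′ e) ∨ (e == f)

    incident : Fin n → Bool
    incident z = does (any? (λ e → (In e Bool.≟ true) ×-dec Inc? e z))

    incident-sound : ∀ {z} → incident z ≡ true → ∃ λ e → In e ≡ true × Inc e z
    incident-sound {z} p with any? (λ e → (In e Bool.≟ true) ×-dec Inc? e z)
    ... | yes q = q

    A U′ : Fin n → Bool
    A = incident ∖ u f ∖ v f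
    U′ z = U z ∧ not (A z)

    A-elim : ∀ {z} → A z ≡ true → (∃ λ e → In e ≡ true × Inc e z) × ¬ Inc f z
    A-elim p = incident-sound (∖-⊆ incident (∖-⊆ (incident ∖ u f) p)) ,
      [ (λ q → ∖-≢ incident (∖-⊆ (incident ∖ u f) p) (sym q)) , (λ q → ∖-≢ (incident ∖ u f) p (sym q)) ]′

    A-intro : ∀ {e z} → In e ≡ true → Inc e z → ¬ Inc f z → A z ≡ true
    A-intro {e} {z} ie iz ni = ∖-intro (incident ∖ u f)
      (∖-intro incident (dec-true (any? (λ e → (In e Bool.≟ true) ×-dec Inc? e z)) (e , ie , iz)) (λ q → ni (inj₁ (sym q))))
      (λ q → ni (inj₂ (sym q)))

    g⇒f : ∀ {z} → Inc g z → Inc f z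
    g⇒f iz with Digon.par digon
    g⇒f (inj₁ p) | inj₁ (a , b) = inj₁ (trans a p)
    g⇒f (inj₂ p) | inj₁ (a , b) = inj₂ (trans b p)
    g⇒f (inj₁ p) | inj₂ (a , b) = inj₂ (trans b p)
    g⇒f (inj₂ p) | inj₂ (a , b) = inj₁ (trans a p)

    near : ∀ {e z} → In e ≡ true → Inc e z → A z ≡ true ⊎ Inc f z
    near {e} {z} ie iz with Inc? f z
    ... | yes p = inj₂ p
    ... | no p = inj₁ (A-intro ie iz p)

    -- The boundary edges `f` and `g` miss `z`, so by `loc` all faces around `z` lie in `R`, as
    -- those of one inner edge do.
    own : ∀ {e z} → H e ≡ true → Inc e z → A z ≡ true → In e ≡ true
    own {e} {z} he iz az with A-elim az
    ... | (e₁ , ie₁ , iz₁) , nf = inside-intro H R he left (trans (sym (uncut R (uncut-at e iz))) left)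
      where
      uncut-at : ∀ a → Inc a z → cut R a ≡ false
      uncut-at a ia = ¬-not (λ c → [ (λ { refl → nf ia }) , (λ { refl → nf (g⇒f ia) }) ]′ (Digon.only digon a c))
      left : R (l e) ≡ true
      left = trans (loc R z uncut-at iz iz₁) (proj₁ (proj₂ (inside-elim H R {e₁} ie₁)))

    f∉In : In f ≡ false
    f∉In = ¬-not (λ p → true≢false (trans (sym (Digon.cutf digon)) (inside-uncut H R p)))

    f∉A : ∀ {z} → Inc f z → A z ≡ false
    f∉A iz = ¬-not (λ az → proj₂ (A-elim az) iz)

    In⊆H : ∀ {e} → In e ≡ true → H e ≡ true
    In⊆H {e} p = proj₁ (inside-elim H R {e} p)

    hf′ : H′ f ≡ true
    hf′ = collapse-intro H R g (cut⊆ f (Digon.cutf digon)) (λ p → true≢false (trans (sym p) f∉In)) (Digon.f≢g digon)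

    smaller : count H′ < count H
    smaller = subst (suc (count H′) ≤_) (sym (count-∖ H (cut⊆ g (Digon.cutg digon))))
      (s≤s (count-mono {P = H′} {Q = H ∖ g} (λ e p → ∖-intro H (proj₁ (collapse-elim H R g {e} p)) (proj₂ (proj₂ (collapse-elim H R g {e} p))))))

    ends′ : ∀ {e z} → H′ e ≡ true → Inc e z → U′ z ≡ true
    ends′ {e} {z} he iz with collapse-elim H R g he
    ... | h , ni , _ = cong₂ _∧_ (ends h iz) (cong not (¬-not (λ az → true≢false (trans (sym (own h iz az)) ni))))

    D′⊆H′ : ∀ {e} → D′ e ≡ true → H′ e ≡ true
    D′⊆H′ {e} p with ∨-true (D e ∧ H′ e) p
    ... | inj₁ q = proj₂ (∧-true (D e) q)
    ... | inj₂ q rewrite ==⇒≡ e f q = hf′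

    df′ : D′ f ≡ true
    df′ = ∨-trueʳ (D f ∧ H′ f) (==-refl f)

    -- The surplus of `Extension` over the piece makes up for `f`, counted in `D′` but perhaps not
    -- in `D`.
    lift : Good H′ U′ D′ → Good H U D
    lift G = record
      { S = X.S
      ; sub = λ p → [ (λ q → proj₁ (∧-true (U _) (G.sub q))) , A⊆U ]′ (X.sub p)
      ; forest = X.forest
      ; marks = marks
      ; size = arith {t = total G.S} {s = total X.S} count-U G.size X.size count-D }
      where
      module G = Good G
      T-out : ∀ {y h} → y ∈ G.S h → A y ≡ false
      T-out {y} p = not-true (proj₂ (∧-true (U y) (G.sub p)))
      apart-f : Apart G.S (u f) (v f)
      apart-f = G.marks df′
      A⊆U : ∀ {y} → A y ≡ true → U y ≡ true
      A⊆U az with A-elim az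
      ... | (e , ie , iz) , _ = ends (In⊆H ie) iz
      h-A : ∀ {e} → In e ≡ true → ∃ λ z → Inc e z × A z ≡ true
      h-A = has-A H In D f A (λ _ → []) simple f∉In near own f∉A (λ ()) (λ _ → [])
      -- Restored edges do not matter yet: an inner edge has an end in `A`, still in no forest, and
      -- `g` has the same ends as the marked `f`.
      T-forest : ∀ h → Forest H (G.S h)
      T-forest h = forest-mono keep (G.forest h)
        where
        keep : ∀ {e} → H e ≡ true → u e ∈ G.S h → v e ∈ G.S h → H′ e ≡ true
        keep {e} he u∈ v∈ = collapse-intro H R g he ¬in e≢g
          where
          ¬in : In e ≢ true
          ¬in ie with h-A ie
          ... | z , inj₁ refl , az = true≢false (trans (sym az) (T-out u∈))
          ... | z , inj₂ refl , az = true≢false (trans (sym az) (T-out v∈))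
          e≢g : e ≢ g
          e≢g refl with Digon.par digon
          ... | inj₁ (a , b) = Apart.disjoint apart-f (subst (_∈ G.S h) (sym a) u∈) (subst (_∈ G.S h) (sym b) v∈) refl
          ... | inj₂ (a , b) = Apart.disjoint apart-f (subst (_∈ G.S h) (sym a) v∈) (subst (_∈ G.S h) (sym b) u∈) refl
      some : ∃ λ x → A x ≡ true
      some with no2 R f g digon cut⊆
      ... | e , ie with h-A ie
      ... | z , _ , az = z , az
      ext : Extension H In D A G.S
      ext with ports apart-f
      ... | i , j , i≢j , b-loc , c-loc = extend H In D f A G.S simple f∉In near own f∉A T-out T-forest i j i≢j b-loc c-loc some
      module X = Extension ext
      old : ∀ {y h} → A y ≡ false → y ∈ X.S h → y ∈ G.S h
      old na p = [ id , (λ q → contradiction (trans (sym q) na) true≢false) ]′ (X.sub p)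
      marks : ∀ {e} → D e ≡ true → Apart X.S (u e) (v e)
      marks {e} de with In e Bool.≟ true | e ≟ g
      ... | yes ie | _ = X.marks ie de
      ... | no ni | no e≢g = apart-⊆ (old (out (inj₁ refl))) (old (out (inj₂ refl))) (G.marks (∨-trueˡ (e == f) (cong₂ _∧_ de he′)))
        where
        he′ : H′ e ≡ true
        he′ = collapse-intro H R g (D⊆H de) ni e≢g
        out : ∀ {z} → Inc e z → A z ≡ false
        out {z} iz = not-true (proj₂ (∧-true (U z) (ends′ he′ iz)))
      ... | no ni | yes refl with Digon.par digon
      ...   | inj₁ (a , b) rewrite sym a | sym b = apart-⊆ (old (f∉A (inj₁ refl))) (old (f∉A (inj₂ refl))) apart-f
      ...   | inj₂ (a , b) rewrite sym a | sym b = apart-swap (apart-⊆ (old (f∉A (inj₁ refl))) (old (f∉A (inj₂ refl))) apart-f)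
      count-U : count U ≡ count U′ + count A
      count-U = trans (sum-cong-≗ pointwise) (∑-distrib-+ (λ z → ⟦ U′ z ⟧) (λ z → ⟦ A z ⟧))
        where
        pointwise : ∀ z → ⟦ U z ⟧ ≡ ⟦ U′ z ⟧ + ⟦ A z ⟧
        pointwise z with A z in az
        ... | true rewrite A⊆U az = refl
        ... | false = trans (cong ⟦_⟧ (sym (∧-identityʳ (U z)))) (sym (+-identityʳ _))
      count-D : count D′ + count (λ e → In e ∧ D e) ≤ count D + 1
      count-D = subst₂ _≤_ (∑-distrib-+ (λ e → ⟦ D′ e ⟧) (λ e → ⟦ In e ∧ D e ⟧))
          (trans (∑-distrib-+ (λ e → ⟦ D e ⟧) (λ e → ⟦ e == f ⟧)) (cong (count D +_) (count-single f)))
          (sum-mono pointwise)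
        where
        pointwise : ∀ e → ⟦ D′ e ⟧ + ⟦ In e ∧ D e ⟧ ≤ ⟦ D e ⟧ + ⟦ e == f ⟧
        pointwise e with e ≟ f
        ... | yes refl rewrite f∉In = ≤-trans (≤-reflexive (+-identityʳ _)) (≤-trans (⟦⟧≤1 _) (m≤n+m 1 _))
        ... | no _ with D e | H′ e in he
        ... | false | _ = ≤-reflexive (cong ⟦_⟧ (∧-zeroʳ (In e)))
        ... | true | true rewrite proj₁ (proj₂ (collapse-elim H R g {e} he)) = ≤-refl
        ... | true | false = ⟦⟧≤1 (In e ∧ true)
      arith : ∀ {t s U U′ A D D′ DI} → U ≡ U′ + A → U′ + 1 ≤ t + D′ → t + A + 1 ≤ s + DI → D′ + DI ≤ D + 1 → U + 1 ≤ s + D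
      arith {t} {s} {U} {U′} {A} {D} {D′} {DI} refl p q r =
        linear (t + D′ + DI + 1) (+-mono-≤ p (+-mono-≤ q r)) (≤-reflexive (lhs t U′ A D′ DI)) (≤-reflexive (rhs t s D D′ DI))
        where
        lhs : ∀ t u a d i → t + d + i + 1 + (u + a + 1) ≡ u + 1 + (t + a + 1 + (d + i))
        lhs = solve-∀
        rhs : ∀ t s D d i → t + d + (s + i + (D + 1)) ≡ t + d + i + 1 + (s + D)
        rhs = solve-∀

  good : ∀ m (H : Fin E → Bool) (U : Fin n → Bool) (D : Fin E → Bool) → count H < m →
    (∀ {e z} → H e ≡ true → Inc e z → U z ≡ true) → (∀ {e} → D e ≡ true → H e ≡ true) →
    No2Face H → (∃ λ f → H f ≡ true) → Good H U D
  good (suc m) H U D bound ends D⊆H no2 (f , hf)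
    with any? (λ e → any? (λ e′ → (H e Bool.≟ true) ×-dec (H e′ Bool.≟ true) ×-dec Par? e e′ ×-dec ¬? (e ≟ e′)))
  ... | no none = Base.good H U D ends D⊆H simple f hf
    where
    simple : Simple H
    simple {e} {e′} he he′ par with e ≟ e′
    ... | yes q = q
    ... | no q = ⊥-elim (none (e , e′ , he , he′ , par , q))
  ... | yes (e , e′ , he , he′ , par , e≢e′) with digon-of-parallel par e≢e′
  ... | R , d = C.lift (good m C.H′ C.U′ C.D′ (≤-trans C.smaller (≤-pred bound)) C.ends′ C.D′⊆H′
                  (collapse-No2Face (Innermost.digon inn) (Innermost.cut⊆ inn) no2) (Innermost.f inn , C.hf′))
    where
    inn : Innermost H
    inn = innermost (suc (count R)) ≤-refl d
      (λ a c → [ (λ q → subst (λ a → H a ≡ true) (sym q) he) , (λ q → subst (λ a → H a ≡ true) (sym q) he′) ]′ (Digon.only d a c))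
    module C = Collapse H U D ends D⊆H no2 inn

-- Plane maps of embedded multigraphs

∈-tail : ∀ {a} {A : Set a} {y z : A} {L} → y ≢ z → y ∈ z ∷ L → y ∈ L
∈-tail ne (here q) = ⊥-elim (ne q)
∈-tail ne (there p) = p

-- Excluded middle for finitely many instances, under a double negation; harmless where a
-- contradiction is sought.
¬¬-decidable : ∀ {N} (P : Fin N → Set) → ¬ ¬ (∀ t → Dec (P t))
¬¬-decidable {zero} P k = k (λ ())
¬¬-decidable {suc N} P k = ¬¬-decidable (P ∘ suc) (λ ds → excluded (λ d → k (λ { zero → d ; (suc t) → ds t })))
  where
  excluded : ¬ ¬ Dec (P zero)
  excluded k = k (no (λ p → k (yes p)))

module FromEmbedding {n : ℕ} (M : Multigraph n) (emb : PlaneEmbeddingWithout2Faces M)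
  (eul : n + PlaneEmbeddingWithout2Faces.F emb ≡ (m M + PlaneEmbeddingWithout2Faces.k emb) + 2) where
  open PlaneEmbeddingWithout2Faces emb

  E : ℕ
  E = m M + k

  Darts : Set
  Darts = Dart M k xends

  rev : Darts → Darts
  rev = α M k xends

  tip : Darts → Fin n
  tip = head M k xends

  eu ev : Fin E → Fin n
  eu e = proj₁ (ends⁺ M k xends e)
  ev e = proj₂ (ends⁺ M k xends e)

  eu≢ev : ∀ e → eu e ≢ ev e
  eu≢ev e with splitAt (m M) e
  ... | inj₁ a = loopless M a
  ... | inj₂ a = xloopless a

  rev-rev : ∀ y → rev (rev y) ≡ y
  rev-rev (e , false) = refl
  rev-rev (e , true) = refl

  face-σ : ∀ y → face (σ y) ≡ face (rev y)
  face-σ y = trans (cong (face ∘ σ) (sym (rev-rev y))) (face-φ (rev y))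

  toDart : Fin (E + E) → Darts
  toDart i = [ (_, false) , (_, true) ]′ (splitAt E i)

  fromDart : Darts → Fin (E + E)
  fromDart (e , false) = e ↑ˡ E
  fromDart (e , true) = E ↑ʳ e

  to-from : ∀ y → toDart (fromDart y) ≡ y
  to-from (e , false) = cong [ (_, false) , (_, true) ]′ (splitAt-↑ˡ E e E)
  to-from (e , true) = cong [ (_, false) , (_, true) ]′ (splitAt-↑ʳ E E e)

  from-to : ∀ i → fromDart (toDart i) ≡ i
  from-to i with splitAt E i in eq
  ... | inj₁ e = splitAt⁻¹-↑ˡ eq
  ... | inj₂ e = splitAt⁻¹-↑ʳ {i = i} eq

  dartSum : (Darts → Bool) → Bool
  dartSum h = xsum (h ∘ toDart)

  dartSum-σ : ∀ h → dartSum (h ∘ σ) ≡ dartSum h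
  dartSum-σ h = trans (xsum-cong (λ i → cong h (sym (to-from (σ (toDart i)))))) (sym (xsum-permute (h ∘ toDart) π))
    where
    π : Permutation (E + E) (E + E)
    π = permutation (λ i → fromDart (σ (toDart i))) (λ i → fromDart (σ⁻¹ (toDart i)))
      (λ i → trans (cong (fromDart ∘ σ) (to-from (σ⁻¹ (toDart i)))) (trans (cong fromDart (σσ⁻¹ (toDart i))) (from-to i)))
      (λ i → trans (cong (fromDart ∘ σ⁻¹) (to-from (σ (toDart i)))) (trans (cong fromDart (σ⁻¹σ (toDart i))) (from-to i)))

  dartSum-edges : ∀ h → dartSum h ≡ xsum (λ e → h (e , false) xor h (e , true))
  dartSum-edges h = trans (xsum-split E (h ∘ toDart))
    (trans (cong₂ _xor_ (xsum-cong (λ e → cong h (to-from (e , false)))) (xsum-cong (λ e → cong h (to-from (e , true)))))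
           (sym (xsum-distrib (λ e → h (e , false)) (λ e → h (e , true)))))

  -- The sum splits over darts into a term with the face of the dart and one with the face of its
  -- reverse. Rotation by `σ` keeps the vertex and turns the second kind into the first, so the two
  -- sums cancel.
  orthogonal : ∀ (X : Fin n → Bool) (R : Fin F → Bool) →
    xsum (λ e → (X (eu e) xor X (ev e)) ∧ (R (face (e , false)) xor R (face (e , true)))) ≡ false
  orthogonal X R = begin
    xsum (λ e → (X (eu e) xor X (ev e)) ∧ (R (face (e , false)) xor R (face (e , true))))
      ≡⟨ xsum-cong (λ e → expand (X (eu e)) (X (ev e)) (R (face (e , false))) (R (face (e , true)))) ⟩
    xsum (λ e → (h (e , false) xor h′ (e , false)) xor (h (e , true) xor h′ (e , true)))
      ≡⟨ sym (dartSum-edges (λ y → h y xor h′ y)) ⟩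
    dartSum (λ y → h y xor h′ y)
      ≡⟨ xsum-distrib (h ∘ toDart) (h′ ∘ toDart) ⟩
    dartSum h xor dartSum h′
      ≡⟨ cong (dartSum h xor_) (trans (xsum-cong (λ i → rotate (toDart i))) (dartSum-σ h)) ⟩
    dartSum h xor dartSum h
      ≡⟨ xor-same (dartSum h) ⟩
    false ∎
    where
    open ≡-Reasoning
    h h′ : Darts → Bool
    h y = X (tip y) ∧ R (face y)
    h′ y = X (tip y) ∧ R (face (rev y))
    rotate : ∀ y → h′ y ≡ h (σ y)
    rotate y = sym (cong₂ (λ a b → X a ∧ R b) (σ-head y) (face-σ y))
    expand : ∀ a b c d → (a xor b) ∧ (c xor d) ≡ ((a ∧ c) xor (a ∧ d)) xor ((b ∧ d) xor (b ∧ c))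
    expand true true true true = refl
    expand true true true false = refl
    expand true true false true = refl
    expand true true false false = refl
    expand true false c d = sym (xor-identityʳ (c xor d))
    expand false true c d = xor-comm c d
    expand false false c d = refl

  Incident : Fin E → Fin n → Set
  Incident e z = eu e ≡ z ⊎ ev e ≡ z

  UncutAt : (Fin F → Bool) → Fin n → Set
  UncutAt R z = ∀ e → Incident e z → R (face (e , false)) xor R (face (e , true)) ≡ false

  around : ∀ R z → UncutAt R z → ∀ j y → tip y ≡ z → tip (iter σ j y) ≡ z × R (face (iter σ j y)) ≡ R (face y)
  around R z uncut zero y ty = ty , refl
  around R z uncut (suc j) y ty with around R z uncut j y ty
  ... | t , q = trans (σ-head y′) t , trans (cong R (face-σ y′)) (trans (flip y′ t) q)
    where
    y′ : Darts
    y′ = iter σ j y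
    flip : ∀ y → tip y ≡ z → R (face (rev y)) ≡ R (face y)
    flip (e , false) p = sym (xor-false (uncut e (inj₁ p)))
    flip (e , true) p = xor-false (uncut e (inj₂ p))

  local : ∀ R z → UncutAt R z → ∀ {e e′} → Incident e z → Incident e′ z → R (face (e , false)) ≡ R (face (e′ , false))
  local R z uncut {e} {e′} i i′ with dart i | dart i′
    where
    dart : ∀ {e} → Incident e z → ∃ λ y → tip y ≡ z × R (face (e , false)) ≡ R (face y)
    dart {e} (inj₁ p) = (e , false) , p , refl
    dart {e} (inj₂ p) = (e , true) , p , xor-false (uncut e (inj₂ p))
  ... | y , ty , q | y′ , ty′ , q′ with σ-trans y y′ (trans ty (sym ty′))
  ... | j , refl = trans q (trans (sym (proj₂ (around R z uncut j y ty))) (sym q′))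

  adjacent : ∀ {a b} ((e , _) : Adj⁺ M k xends a b) → Incident e a × Incident e b
  adjacent (e , inj₁ p) = inj₁ (cong proj₁ p) , inj₂ (cong proj₂ p)
  adjacent (e , inj₂ p) = inj₂ (cong proj₂ p) , inj₁ (cong proj₁ p)

  connect : ∀ {p} (X : Fin n → Fin p) → (∀ e → X (eu e) ≡ X (ev e)) → ∀ a b → X a ≡ X b
  connect X closed a b = go (connected a b)
    where
    go : ∀ {a b} → Star (Adj⁺ M k xends) a b → X a ≡ X b
    go ε = refl
    go ((e , inj₁ p) ◅ s) = trans (subst (λ t → X (proj₁ t) ≡ X (proj₂ t)) p (closed e)) (go s)
    go ((e , inj₂ p) ◅ s) = trans (sym (subst (λ t → X (proj₁ t) ≡ X (proj₂ t)) p (closed e))) (go s)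

  -- Along a walk in the connected map, `local` at each vertex transports the value of `R` from one
  -- edge to the next.
  dual-connect : ∀ R → (∀ e → R (face (e , false)) xor R (face (e , true)) ≡ false) → ∀ s t → R s ≡ R t
  dual-connect R uncut s t with face-surj s | face-surj t
  ... | y , refl | y′ , refl = trans (left y) (trans (walk (connected (eu (proj₁ y)) (eu (proj₁ y′))) (inj₁ refl) (inj₁ refl)) (sym (left y′)))
    where
    left : ∀ y → R (face y) ≡ R (face (proj₁ y , false))
    left (e , false) = refl
    left (e , true) = sym (xor-false (uncut e))
    walk : ∀ {a b e e′} → Star (Adj⁺ M k xends) a b → Incident e a → Incident e′ b → R (face (e , false)) ≡ R (face (e′ , false))
    walk {a} ε i i′ = local R a (λ e _ → uncut e) i i′
    walk {a} (d ◅ s) i i′ = trans (local R a (λ e _ → uncut e) i (proj₁ (adjacent d))) (walk s (proj₂ (adjacent d)) i′)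

  map : PlaneMap n E F
  map = record
    { u = eu ; v = ev ; l = λ e → face (e , false) ; r = λ e → face (e , true) ; u≢v = eu≢ev ; euler = eul
    ; orth = orthogonal ; loc = local ; conn = connect ; dconn = dual-connect }

  open PlaneMap map
  open Digons map
  open Forests map
  open Assembly map

  -- Faces of the multigraph within the connected map

  real : Fin E → Bool
  real e = [ (λ _ → true) , (λ _ → false) ]′ (splitAt (m M) e)

  real-intro : ∀ a → real (a ↑ˡ k) ≡ true
  real-intro a = cong [ (λ _ → true) , (λ _ → false) ]′ (splitAt-↑ˡ (m M) a k)

  real-elim : ∀ {e} → real e ≡ true → ∃ λ a → a ↑ˡ k ≡ e
  real-elim {e} p with splitAt (m M) e in eq
  ... | inj₁ a = a , splitAt⁻¹-↑ˡ eq

  Same : Darts → Darts → Set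
  Same = SameFace M k xends σ

  orbit-same : ∀ j y → Same y (iter (λ x → σ (rev x)) j y)
  orbit-same zero y = ε
  orbit-same (suc j) y = orbit-same j y ◅◅ (φ-step (iter (λ x → σ (rev x)) j y) ◅ ε)

  face-same : ∀ {y y′} → face y ≡ face y′ → Same y y′
  face-same {y} {y′} p with face-orbit y y′ p
  ... | j , refl = orbit-same j y

  extra-or-real : ∀ e → real e ≡ true ⊎ (∃ λ x → e ≡ m M ↑ʳ x)
  extra-or-real e with splitAt (m M) e in eq
  ... | inj₁ a = inj₁ refl
  ... | inj₂ x = inj₂ (x , sym (splitAt⁻¹-↑ʳ {i = e} eq))

  extra-not-real : ∀ {e x} → e ≡ m M ↑ʳ x → real e ≡ false
  extra-not-real {x = x} refl = cong [ (λ _ → true) , (λ _ → false) ]′ (splitAt-↑ʳ (m M) k x)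

  -- A set of faces bounded by real edges is a union of faces of `M`: crossing an extra edge does
  -- not leave it.
  same-region : ∀ R → cut R ⊆ real → ∀ {y y′} → Same y y′ → R (face y) ≡ R (face y′)
  same-region R cR ε = refl
  same-region R cR (φ-step y ◅ s) = trans (cong R (sym (face-φ y))) (same-region R cR s)
  same-region R cR (x-step (e , b) (x , p) ◅ s) = trans (across b) (same-region R cR s)
    where
    uncut-e : cut R e ≡ false
    uncut-e = ¬-not (λ c → true≢false (trans (sym (cR e c)) (extra-not-real p)))
    across : ∀ b → R (face (e , b)) ≡ R (face (e , not b))
    across false = xor-false uncut-e
    across true = sym (xor-false uncut-e)

  cut-dart : ∀ (R : Fin F → Bool) {e : Fin E} → cut R e ≡ true → ∃ λ b → R (face (e , b)) ≡ true × R (face (e , not b)) ≡ false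
  cut-dart R {e} c with R (face (e , false)) in p | R (face (e , true)) in q
  ... | true | false = false , p , q
  ... | false | true = true , q , p

  side-unique : ∀ (R : Fin F → Bool) {e : Fin E} {b b′ : Bool} → R (face (e , b)) ≡ true → R (face (e , not b)) ≡ false → R (face (e , b′)) ≡ true → b′ ≡ b
  side-unique R {b = false} {false} p q r = refl
  side-unique R {b = false} {true} p q r = contradiction (trans (sym r) q) true≢false
  side-unique R {b = true} {false} p q r = contradiction (trans (sym r) q) true≢false
  side-unique R {b = true} {true} p q r = refl

  -- With no real edge inside `R`, the only real sides in `R` are one of `f` and one of `g`. Once
  -- these are seen to lie in the same face of `M`, that face is a 2-face.
  real-No2Face : No2Face real
  real-No2Face R f g d cR with findTrue (inside real R)
  ... | inj₁ found = found
  ... | inj₂ none with real-elim (cR f (Digon.cutf d)) | real-elim (cR g (Digon.cutg d)) | cut-dart R (Digon.cutf d) | cut-dart R (Digon.cutg d)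
  ... | a , refl | a′ , refl | b , Rb , Rb̄ | b′ , Rb′ , Rb̄′ =
      ⊥-elim (¬¬same (λ same → no2face ((a , b) , (a′ , b′) , distinct , same , only)))
    where
    y₁ y₂ : Darts
    y₁ = a ↑ˡ k , b
    y₂ = a′ ↑ˡ k , b′
    distinct : (a , b) ≢ (a′ , b′)
    distinct q = Digon.f≢g d (cong (λ t → proj₁ t ↑ˡ k) q)
    on-boundary : ∀ {e} → real e ≡ true → ∀ b → R (face (e , b)) ≡ true → e ≡ a ↑ˡ k ⊎ e ≡ a′ ↑ˡ k
    on-boundary {e} re b p with cut R e in ce
    ... | true = Digon.only d e ce
    ... | false = contradiction (trans (sym (inside-intro real R re (both b p false) (both b p true))) (none e)) true≢false
      where
      both : ∀ b → R (face (e , b)) ≡ true → ∀ c → R (face (e , c)) ≡ true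
      both false p false = p
      both false p true = trans (sym (xor-false ce)) p
      both true p false = trans (xor-false ce) p
      both true p true = p
    only : ∀ y → Same y₁ (realDart M k xends y) → y ≡ (a , b) ⊎ y ≡ (a′ , b′)
    only (c , s) sm with on-boundary (real-intro c) s Rc
      where
      Rc : R (face (c ↑ˡ k , s)) ≡ true
      Rc = trans (sym (same-region R cR sm)) Rb
    ... | inj₁ q with ↑ˡ-injective k c a q
    ...   | refl = inj₁ (cong (c ,_) (side-unique R Rb Rb̄ (trans (sym (same-region R cR sm)) Rb)))
    only (c , s) sm | inj₂ q with ↑ˡ-injective k c a′ q
    ...   | refl = inj₂ (cong (c ,_) (side-unique R Rb′ Rb̄′ (trans (sym (same-region R cR sm)) Rb)))
    Reached : Fin F → Set
    Reached t = ∃ λ y → face y ≡ t × Same y₁ y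
    reached-dart : ∀ {y} → Reached (face y) → Same y₁ y
    reached-dart (y′ , p , sm) = sm ◅◅ face-same p
    ¬¬same : ¬ ¬ Same y₁ y₂
    ¬¬same ns = ¬¬-decidable Reached (λ dec → ns (reach dec))
      where
      module _ (dec : ∀ t → Dec (Reached t)) where
        -- The faces merged with that of `y₁`. Extra edges are not in the boundary of `R₁`, so this
        -- lies in the pair of boundary edges of `R`; by `both-cut` it contains the second one, so
        -- `y₂` is reached.
        R₁ : Fin F → Bool
        R₁ t = does (dec t)
        R₁-sound : ∀ {t} → R₁ t ≡ true → Reached t
        R₁-sound {t} p with dec t
        ... | yes q = q
        R₁-complete : ∀ {y} → Same y₁ y → R₁ (face y) ≡ true
        R₁-complete {y} sm = dec-true (dec (face y)) (y , refl , sm)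
        R₁⊆R : ∀ {t} → R₁ t ≡ true → R t ≡ true
        R₁⊆R p with R₁-sound p
        ... | y , refl , sm = trans (sym (same-region R cR sm)) Rb
        boundary : ∀ e → cut R₁ e ≡ true → e ≡ a ↑ˡ k ⊎ e ≡ a′ ↑ˡ k
        boundary e c with cut-dart R₁ c
        ... | s , p , p̄ with extra-or-real e
        ... | inj₁ re = on-boundary re s (R₁⊆R p)
        ... | inj₂ (x , q) = contradiction (trans (sym (R₁-complete (reached-dart (R₁-sound p) ◅◅ (x-step (e , s) (x , q) ◅ ε)))) p̄) true≢false
        proper₁ : Proper R₁
        proper₁ = (face y₁ , R₁-complete ε) , (face (a ↑ˡ k , not b) , ¬-not (λ p → true≢false (trans (sym (R₁⊆R p)) Rb̄)))
        reach : Same y₁ y₂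
        reach with cut-dart R₁ (proj₂ (both-cut R₁ proper₁ boundary))
        ... | s , p , _ = reached-dart (subst (λ s → Reached (face (a′ ↑ˡ k , s))) (side-unique R Rb′ Rb̄′ (R₁⊆R p)) (R₁-sound p))

  -- From lists to induced forests

  last-or-inject : ∀ {N} (i : Fin (suc N)) → i ≡ fromℕ N ⊎ ∃ λ j → i ≡ inject₁ j
  last-or-inject {zero} zero = inj₁ refl
  last-or-inject {suc N} zero = inj₂ (zero , refl)
  last-or-inject {suc N} (suc i) with last-or-inject i
  ... | inj₁ refl = inj₁ refl
  ... | inj₂ (j , refl) = inj₂ (suc j , refl)

  previous : ∀ {N} → Fin (suc (suc N)) → Fin (suc (suc N))
  previous {N} zero = fromℕ (suc N)
  previous (suc j) = inject₁ j

  previous-≢ : ∀ {N} (i : Fin (suc (suc N))) → i ≢ previous i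
  previous-≢ (suc i) q = suc≢inject₁ i q
    where
    suc≢inject₁ : ∀ {N} (i : Fin N) → suc i ≢ inject₁ i
    suc≢inject₁ (suc i) q = suc≢inject₁ i (Fin-suc-injective q)

  joined : ∀ {e a b} → Joins (ends M) e a b → Joined (e ↑ˡ k) a b
  joined {e} j rewrite splitAt-↑ˡ (m M) e k = go j
    where
    go : ∀ {a b} → Joins (ends M) e a b → (proj₁ (ends M e) ≡ a × proj₂ (ends M e) ≡ b) ⊎ (proj₂ (ends M e) ≡ a × proj₁ (ends M e) ≡ b)
    go (inj₁ p) = inj₁ (cong proj₁ p , cong proj₂ p)
    go (inj₂ p) = inj₂ (cong proj₂ p , cong proj₁ p)

  joins-sym : ∀ {e a b} → Joins (ends M) e a b → Joins (ends M) e b a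
  joins-sym (inj₁ p) = inj₂ p
  joins-sym (inj₂ p) = inj₁ p

  joins-≢ : ∀ {e a b} → Joins (ends M) e a b → a ≢ b
  joins-≢ {e} (inj₁ p) refl = loopless M e (trans (cong proj₁ p) (sym (cong proj₂ p)))
  joins-≢ {e} (inj₂ p) refl = loopless M e (trans (cong proj₁ p) (sym (cong proj₂ p)))

  -- The vertex of a cycle placed last has two cycle edges to earlier vertices.
  acyclic : ∀ {N} (vs : Fin (suc (suc (suc N))) → Fin n) (es : Fin (suc (suc N)) → Fin (m M)) →
    vs (fromℕ (suc (suc N))) ≡ vs zero → (∀ {i j} → es i ≡ es j → i ≡ j) →
    (∀ i → Joins (ends M) (es i) (vs (inject₁ i)) (vs (suc i))) →
    ∀ {L} → Forest real L → ¬ (∀ i → vs i ∈ L)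
  acyclic vs es closed inj js [] on = contradiction (on zero) (λ ())
  acyclic {N} vs es closed inj js {z ∷ L} (cons z∉ un fo) on with any? (λ i → vs (inject₁ i) ≟ z)
  ... | no off = acyclic vs es closed inj js fo (λ i → ∈-tail (off′ i) (on i))
    where
    off′ : ∀ i → vs i ≢ z
    off′ i q with last-or-inject i
    ... | inj₁ refl = off (zero , trans (sym closed) q)
    ... | inj₂ (j , refl) = off (j , q)
  ... | yes (i , refl) = previous-≢ i (inj (↑ˡ-injective k (es i) (es (previous i))
      (un (real-intro (es i)) (real-intro (es (previous i))) (joined (js i)) (joined before)
          (∈-tail (joins-≢ (js i) ∘ sym) (on (suc i))) (∈-tail (joins-≢ before ∘ sym) (on (inject₁ (previous i)))))))
    where
    suc-previous : ∀ i → vs (suc (previous i)) ≡ vs (inject₁ i)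
    suc-previous zero = closed
    suc-previous (suc j) = refl
    before : Joins (ends M) (es (previous i)) (vs (inject₁ i)) (vs (inject₁ (previous i)))
    before = joins-sym {es (previous i)} (subst (Joins (ends M) (es (previous i)) (vs (inject₁ (previous i)))) (suc-previous i) (js (previous i)))

  toSubset : List (Fin n) → Subset n
  toSubset L = tabulate (λ y → mem y L)

  toSubset-∈ : ∀ {y} L → y Subset.∈ toSubset L → y ∈ L
  toSubset-∈ {y} L p = mem-sound y L (trans (sym (lookup∘tabulate (λ y → mem y L) y)) ([]=⇒lookup p))

  toSubset-forest : ∀ {L} → Forest real L → InducedForest M (toSubset L)
  toSubset-forest {L} fo (C , on) = go (Cycle.len C) (Cycle.len≥2 C) (Cycle.vs C) (Cycle.es C) (Cycle.closed C) (Cycle.es-inj C) (Cycle.joins C) on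
    where
    go : ∀ N → 2 ≤ N → (vs : Fin (suc N) → Fin n) (es : Fin N → Fin (m M)) → vs (fromℕ N) ≡ vs zero →
      (∀ {i j} → es i ≡ es j → i ≡ j) → (∀ i → Joins (ends M) (es i) (vs (inject₁ i)) (vs (suc i))) →
      ¬ (∀ i → vs i Subset.∈ toSubset L)
    go (suc (suc N)) (s≤s (s≤s _)) vs es cl inj js on = acyclic vs es cl inj js fo (λ i → toSubset-∈ L (on i))

  length≤ : ∀ {H L} → Forest H L → length L ≤ count (λ y → mem y L)
  length≤ [] = z≤n
  length≤ {L = z ∷ L} (cons z∉ _ fo) = subst (suc (length L) ≤_) (sym (count-∖ (λ y → mem y (z ∷ L)) (mem-complete {z} {z ∷ L} (here refl))))
    (s≤s (≤-trans (length≤ fo) (count-mono {P = λ y → mem y L} {Q = (λ y → mem y (z ∷ L)) ∖ z}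
      (λ y p → ∖-intro (λ y → mem y (z ∷ L)) (mem-complete {y} {z ∷ L} (there (mem-sound y L p))) (λ { refl → z∉ (mem-sound y L p) })))))

  size-tabulate : ∀ {N} (P : Fin N → Bool) → ∣ tabulate P ∣ ≡ count P
  size-tabulate {zero} P = refl
  size-tabulate {suc N} P with P zero
  ... | true = cong suc (size-tabulate (P ∘ suc))
  ... | false = size-tabulate (P ∘ suc)

  -- A third of n + 1 is more than enough, as 10(n + 1) ≥ 9n + 7; otherwise 30(n + 1) ≤ 3(9n + 6).
  large-class : ∀ S → n + 1 ≤ total S → ∃ λ h → 9 * n + 7 ≤ 30 * length (S h)
  large-class S bound with any? (λ h → 9 * n + 7 ≤? 30 * length (S h))
  ... | yes p = p
  ... | no ¬p = contradiction (≤-trans (*-monoʳ-≤ 30 bound) (≤-trans (≤-reflexive (sym (sum-*ˡ 30 (λ h → length (S h)))))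
      (sum-mono (λ h → ≤-pred (subst (suc (30 * length (S h)) ≤_) (+-suc (9 * n) 6) (≰⇒> (λ q → ¬p (h , q))))))))
      (<⇒≱ (subst₂ _≤_ (lhs n) (rhs n) (m≤m+n (27 * n + 19) (3 * n + 11))))
    where
    lhs : ∀ n → 27 * n + 19 ≡ suc (9 * n + 6 + (9 * n + 6 + (9 * n + 6 + 0)))
    lhs = solve-∀
    rhs : ∀ n → 27 * n + 19 + (3 * n + 11) ≡ 30 * (n + 1)
    rhs = solve-∀

  conclusion : (∃ λ f → real f ≡ true) → ∃[ S ] (InducedForest M S × 9 * n + 7 ≤ 30 * ∣ S ∣)
  conclusion some = toSubset (G.S h) , toSubset-forest (G.forest h) ,
      ≤-trans (proj₂ big) (*-monoʳ-≤ 30 (≤-trans (length≤ (G.forest h)) (≤-reflexive (sym (size-tabulate (λ y → mem y (G.S h)))))))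
    where
    module G = Good (good (suc (count real)) real (λ _ → true) (λ _ → false) ≤-refl (λ _ _ → refl) (λ ()) real-No2Face some)
    big : ∃ λ h → 9 * n + 7 ≤ 30 * length (G.S h)
    big = large-class G.S (subst₂ _≤_ (cong (_+ 1) (count-true {n})) (trans (cong (total G.S +_) (count-false {E} (λ _ → false) (λ _ → refl))) (+-identityʳ _)) G.size)
    h : Fin 3
    h = proj₁ big

-- Separate because the induction starts from an edge. All vertices form a forest, and 21n ≥ 7.
edgeless : ∀ {n} (M : Multigraph n) → 1 ≤ n → (Fin (m M) → ⊥) → ∃[ S ] (InducedForest M S × 9 * n + 7 ≤ 30 * ∣ S ∣)
edgeless {n} M n≥1 none = ⊤ , (λ { (C , _) → none (Cycle.es C (Fin.fromℕ< (≤-trans (s≤s z≤n) (Cycle.len≥2 C)))) }) ,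
    subst (λ t → 9 * n + 7 ≤ 30 * t) (sym (∣⊤∣≡n n)) (≤-trans (+-monoʳ-≤ (9 * n) (≤-trans (m≤m+n 7 14) (*-monoʳ-≤ 21 n≥1))) (≤-reflexive (arith n)))
  where
  arith : ∀ n → 9 * n + 21 * n ≡ 30 * n
  arith = solve-∀

theorem18 : ∀ {n : ℕ} (M : Multigraph n) → 1 ≤ n →
    PlaneEmbeddingWithout2Faces M →
    ∃[ S ] (InducedForest M S × 9 * n + 7 ≤ 30 * ∣ S ∣)
theorem18 M n≥1 emb with PlaneEmbeddingWithout2Faces.euler emb
... | inj₁ empty = edgeless M n≥1 (λ e → contradiction (subst Fin (m+n≡0⇒m≡0 (m M) empty) e) (λ ()))
... | inj₂ eul with findTrue (FromEmbedding.real M emb eul)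
... | inj₁ some = FromEmbedding.conclusion M emb eul some
... | inj₂ none = edgeless M n≥1 (λ e → true≢false (trans (sym (FromEmbedding.real-intro M emb eul e)) (none (e ↑ˡ _))))
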